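{- Put $E=C_2\times C_2\times C_6$ and $G=C_2\times C_{12}$. Then $$S_{\mathrm{odd}}(E)\subsetneq S_{\mathrm{odd}}(G).$$ For every integer $r\ge0$, $$D_r=3^4\cdot5\cdot13\cdot73^{\,r+1}\in S_{\mathrm{odd}}(G)\setminus S_{\mathrm{odd}}(E).$$
   Context: For a finite group $G$, $S(G)=\{\det(a_{gh^{ -1}})_{g,h\in G}:a_g\in\mathbb Z\}$ is its integer group determinant set, and $S_{\mathrm{odd}}(G)$ is the set of odd members of $S(G)$. $C_n$ is the cyclic group of order $n$. -}

module Defs where

open import Algebra.Bundles using (CommutativeRing; Group)
import Algebra.Construct.DirectProduct as DirectProduct
import Algebra.Properties.Semiring.Exp as Exp
import Algebra.Properties.Semiring.Sum as Sum
open import Data.Fin.Base using (Fin; zero; suc; toℕ; punchIn)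
open import Data.Fin.Properties using (toℕ-injective; toℕ-fromℕ<; toℕ<n; toℕ≤n; *↔×)
open import Data.Integer.Base using (ℤ; +_)
open import Data.Integer.Divisibility using (_∣_)
import Data.Integer.Properties as ℤ
open import Data.Nat.Base using (ℕ; zero; suc; _+_; _*_; _∸_; _^_; NonZero)
open import Data.Nat.DivMod
  using (_%_; _mod_; m%n<n; m%n%n≡m%n; m*n%n≡0; m<n⇒m%n≡m; n%n≡0; %-distribˡ-+)
open import Data.Nat.Properties using (+-assoc; +-comm; m∸n+n≡m)
open import Data.Product.Base using (_,_; Σ-syntax)
open import Data.Product.Function.NonDependent.Setoid using (_×-inverse_)
open import Data.Product.Relation.Binary.Pointwise.NonDependent using (Pointwise-≡↔≡)
open import Function.Bundles using (Func; Inverse)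
import Function.Construct.Composition as Composition
import Function.Construct.Identity as Identity
import Function.Construct.Symmetry as Symmetry
open import Level using (Level; 0ℓ; _⊔_) renaming (suc to lsuc)
open import Relation.Binary.PropositionalEquality
  using (_≡_; trans; cong; cong₂; setoid; isEquivalence; module ≡-Reasoning)
open import Relation.Nullary.Negation using (¬_)
open import Relation.Unary using (Pred; _∩_)

private
  variable
    c ℓ c₁ ℓ₁ c₂ ℓ₂ : Level

module Determinant (R : CommutativeRing c ℓ) where
  open CommutativeRing R using (Carrier; 1#; semiring)
    renaming (_*_ to _·_; -_ to neg)
  open Sum semiring using (sum)
  open Exp semiring using () renaming (_^_ to _^ᴿ_)

  -- Laplace expansion along the first row; punchIn j enumerates, in order,
  -- the columns other than j.
  det : ∀ {n} → (Fin n → Fin n → Carrier) → Carrier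
  det {zero}  A = 1#
  det {suc n} A = sum λ j →
    (neg 1# ^ᴿ toℕ j) · A zero j · det (λ i k → A (suc i) (punchIn j k))

open Determinant ℤ.+-*-commutativeRing public using (det)

record FiniteGroup c ℓ : Set (lsuc (c ⊔ ℓ)) where
  field
    group       : Group c ℓ
    order       : ℕ
    enumeration : Inverse (setoid (Fin order)) (Group.setoid group)

  open Group group public

  element : Fin order → Carrier
  element = Inverse.to enumeration

-- The matrix (a_{gh⁻¹})_{g,h} has rows and columns listed in the order of the
-- chosen enumeration. Another enumeration permutes rows and columns
-- simultaneously, so the determinant does not depend on this choice.
groupDeterminant : (G : FiniteGroup c ℓ) → (FiniteGroup.Carrier G → ℤ) → ℤ
groupDeterminant G a = det λ i j → a (element i ∙ element j ⁻¹)
  where open FiniteGroup G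

-- The coefficients form a function on the group, hence one that respects _≈_.
S : FiniteGroup c ℓ → Pred ℤ (c ⊔ ℓ)
S G m = Σ[ a ∈ Func (FiniteGroup.setoid G) (setoid ℤ) ]
          groupDeterminant G (Func.to a) ≡ m

Odd : Pred ℤ 0ℓ
Odd m = ¬ (+ 2 ∣ m)

Sₒ : FiniteGroup c ℓ → Pred ℤ (c ⊔ ℓ)
Sₒ G = S G ∩ Odd

-- The cyclic group of order n: residues 0, …, n ∸ 1 under addition modulo n.
module _ (n : ℕ) .{{_ : NonZero n}} where
  open ≡-Reasoning

  private
    _⊕_ : Fin n → Fin n → Fin n
    i ⊕ j = (toℕ i + toℕ j) mod n

    ⊖_ : Fin n → Fin n
    ⊖ i = (n ∸ toℕ i) mod n

    toℕ-mod : ∀ m → toℕ (m mod n) ≡ m % n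
    toℕ-mod m = toℕ-fromℕ< (m%n<n m n)

    toℕ-% : ∀ (i : Fin n) → toℕ i % n ≡ toℕ i
    toℕ-% i = m<n⇒m%n≡m (toℕ<n i)

    %-absorbˡ : ∀ m k → (m % n + k) % n ≡ (m + k) % n
    %-absorbˡ m k = begin
      (m % n + k) % n          ≡⟨ %-distribˡ-+ (m % n) k n ⟩
      (m % n % n + k % n) % n  ≡⟨ cong (λ x → (x + k % n) % n) (m%n%n≡m%n m n) ⟩
      (m % n + k % n) % n      ≡⟨ %-distribˡ-+ m k n ⟨
      (m + k) % n              ∎

    ⊕-comm : ∀ i j → i ⊕ j ≡ j ⊕ i
    ⊕-comm i j = cong (_mod n) (+-comm (toℕ i) (toℕ j))

    toℕ-[⊕]⊕ : ∀ i j k → toℕ ((i ⊕ j) ⊕ k) ≡ (toℕ i + toℕ j + toℕ k) % n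
    toℕ-[⊕]⊕ i j k = begin
      toℕ ((i ⊕ j) ⊕ k)                    ≡⟨ toℕ-mod _ ⟩
      (toℕ (i ⊕ j) + toℕ k) % n            ≡⟨ cong (λ x → (x + toℕ k) % n) (toℕ-mod _) ⟩
      ((toℕ i + toℕ j) % n + toℕ k) % n    ≡⟨ %-absorbˡ _ (toℕ k) ⟩
      (toℕ i + toℕ j + toℕ k) % n          ∎

    ⊕-assoc : ∀ i j k → (i ⊕ j) ⊕ k ≡ i ⊕ (j ⊕ k)
    ⊕-assoc i j k = toℕ-injective (begin
      toℕ ((i ⊕ j) ⊕ k)              ≡⟨ toℕ-[⊕]⊕ i j k ⟩
      (toℕ i + toℕ j + toℕ k) % n    ≡⟨ cong (_% n) (+-assoc (toℕ i) _ _) ⟩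
      (toℕ i + (toℕ j + toℕ k)) % n  ≡⟨ cong (_% n) (+-comm (toℕ i) _) ⟩
      (toℕ j + toℕ k + toℕ i) % n    ≡⟨ toℕ-[⊕]⊕ j k i ⟨
      toℕ ((j ⊕ k) ⊕ i)              ≡⟨ cong toℕ (⊕-comm (j ⊕ k) i) ⟩
      toℕ (i ⊕ (j ⊕ k))              ∎)

    ⊕-identityˡ : ∀ i → (0 mod n) ⊕ i ≡ i
    ⊕-identityˡ i = toℕ-injective (begin
      toℕ ((0 mod n) ⊕ i)          ≡⟨ toℕ-mod _ ⟩
      (toℕ (0 mod n) + toℕ i) % n  ≡⟨ cong (λ x → (x + toℕ i) % n) (toℕ-mod 0) ⟩
      (0 % n + toℕ i) % n          ≡⟨ %-absorbˡ 0 (toℕ i) ⟩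
      toℕ i % n                    ≡⟨ toℕ-% i ⟩
      toℕ i                        ∎)

    ⊕-inverseˡ : ∀ i → (⊖ i) ⊕ i ≡ 0 mod n
    ⊕-inverseˡ i = toℕ-injective (begin
      toℕ ((⊖ i) ⊕ i)                ≡⟨ toℕ-mod _ ⟩
      (toℕ (⊖ i) + toℕ i) % n        ≡⟨ cong (λ x → (x + toℕ i) % n) (toℕ-mod _) ⟩
      ((n ∸ toℕ i) % n + toℕ i) % n  ≡⟨ %-absorbˡ _ (toℕ i) ⟩
      (n ∸ toℕ i + toℕ i) % n        ≡⟨ cong (_% n) (m∸n+n≡m (toℕ≤n i)) ⟩
      n % n                          ≡⟨ n%n≡0 n ⟩
      0                              ≡⟨ m*n%n≡0 0 n ⟨
      0 % n                          ≡⟨ toℕ-mod 0 ⟨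
      toℕ (0 mod n)                  ∎)

  cyclicGroup : Group 0ℓ 0ℓ
  cyclicGroup = record
    { Carrier = Fin n
    ; _≈_     = _≡_
    ; _∙_     = _⊕_
    ; ε       = 0 mod n
    ; _⁻¹     = ⊖_
    ; isGroup = record
      { isMonoid = record
        { isSemigroup = record
          { isMagma = record
            { isEquivalence = isEquivalence
            ; ∙-cong        = cong₂ _⊕_
            }
          ; assoc = ⊕-assoc
          }
        ; identity = ⊕-identityˡ , λ i → trans (⊕-comm i _) (⊕-identityˡ i)
        }
      ; inverse = ⊕-inverseˡ , λ i → trans (⊕-comm i _) (⊕-inverseˡ i)
      ; ⁻¹-cong = cong ⊖_
      }
    }

  C : FiniteGroup 0ℓ 0ℓ
  C = record
    { group       = cyclicGroup
    ; order       = n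
    ; enumeration = Identity.inverse (setoid (Fin n))
    }

infixr 2 _×ᴳ_

_×ᴳ_ : FiniteGroup c₁ ℓ₁ → FiniteGroup c₂ ℓ₂ → FiniteGroup (c₁ ⊔ c₂) (ℓ₁ ⊔ ℓ₂)
G ×ᴳ H = record
  { group       = DirectProduct.group G.group H.group
  ; order       = G.order * H.order
  ; enumeration =
      Composition.inverse *↔×
        (Composition.inverse (Symmetry.inverse Pointwise-≡↔≡)
          (G.enumeration ×-inverse H.enumeration))
  }
  where
  module G = FiniteGroup G
  module H = FiniteGroup H

E G : FiniteGroup 0ℓ 0ℓ
E = C 2 ×ᴳ C 2 ×ᴳ C 6
G = C 2 ×ᴳ C 12

D : ℕ → ℤ
D r = + (3 ^ 4 * 5 * 13 * 73 ^ (r + 1))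

{-# OPTIONS --safe #-}

-- Over ℤ[C₃] the determinant of E becomes the norm of the product of the eight
-- values at the characters of C₂³. After multiplication by an element of C₃ an
-- odd determinant has all values congruent to 1 modulo 2, and then their product
-- is congruent to 1 modulo 8. So Sₒ E consists of norms of elements 1 + 8m, and
-- such a norm is the determinant of 1 + m Σ on G, Σ the sum over C₂ × C₄.
--
-- If D r were the norm of 1 + 8m it would be s · N(π), with s the value of 1 + 8m
-- at 1 and π ∈ ℤ[ω], π ≡ 1 modulo 8. Both factors are divisible by 3. The primes
-- above 73 can be chosen congruent to 1 modulo 8 and removed from s and π one by
-- one; the congruences modulo 8 then leave N(π) = 9 or 585, which is impossible.
-- On G, by contrast, D r is the determinant of
-- (−1 + x⁵ + x⁹) + (−1 + x⁶) σ + k Σ, where 73^r = 1 + 24k, x and σ generate the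
-- factors and Σ is the sum over G.
module Submission where

open import Defs
open import Data.Nat using (ℕ)
open import Data.Product using (_×_)
open import Relation.Unary using (_∈_; _⊂_; _∖_)

open import Algebra.Bundles using (CommutativeRing; Group)
import Algebra.Properties.Ring as RingProperties
import Algebra.Properties.Semiring.Exp as Exp
import Algebra.Properties.Semiring.Sum as SumProperties
import Algebra.Solver.CommutativeMonoid as ProductSolver
open import Data.Fin.Base
  using (Fin; zero; suc; toℕ; punchIn; lift; combine; splitAt; _↑ˡ_; _↑ʳ_)
open import Data.Fin.Patterns
open import Data.Fin.Properties
  using (_≟_; all?; suc-injective; toℕ-injective; toℕ-↑ˡ; ↑ˡ-injective; ↑ʳ-injective;
         splitAt-↑ˡ; splitAt-↑ʳ; splitAt⁻¹-↑ˡ; splitAt⁻¹-↑ʳ; remQuot-combine)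
import Data.Integer.Divisibility.Signed as Signed
import Data.Integer.DivMod as ℤ
import Data.Integer.Properties as ℤ
open import Data.Integer.Solver using (module +-*-Solver)
open import Data.Integer.Tactic.RingSolver using (solve-∀)
open import Data.List.Base using (List; []; _∷_)
open import Data.List.Membership.Propositional using () renaming (_∈_ to _∈ᴸ_)
open import Data.List.Relation.Unary.All as All using (All)
open import Data.List.Relation.Unary.Any using (here; there)
open import Data.Maybe.Base using (just; nothing)
import Data.Nat.Base as ℕ
import Data.Nat.Divisibility as ℕ
open import Data.Nat.DivMod using (_%_; _mod_; [m+kn]%n≡m%n)
open import Data.Nat.Primality using (Prime; prime?; euclidsLemma)
import Data.Nat.Properties as ℕ
open import Data.Product.Base using (_,_; proj₁; proj₂; Σ-syntax; ∃-syntax)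
import Data.Sum.Base as ⊎
open import Data.Sum.Base using (_⊎_; inj₁; inj₂; [_,_]′)
open import Data.Vec.Functional using (Vector; tail; updateAt; _++_)
open import Data.Vec.Functional.Properties
  using (updateAt-updates; updateAt-minimal; lookup-++ˡ; lookup-++ʳ)
open import Function.Base using (_∘_; const)
open import Function.Bundles using (Func)
open import Level using (Level; 0ℓ; _⊔_)
import Relation.Binary.PropositionalEquality as ≡
open ≡ using (_≡_; _≢_; _≗_)
open import Relation.Nullary.Decidable
  using (Dec; yes; no; from-yes; from-no; ¬?; _×-dec_; _⊎-dec_; _→-dec_)
open import Relation.Nullary.Negation using (contradiction; ¬_)
open import Relation.Unary using (_∉_; _⊆_)
open import Tactic.RingSolver using () renaming (solve-∀ to solve-∀-over)
open import Tactic.RingSolver.Core.AlmostCommutativeRing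
  using (AlmostCommutativeRing; fromCommutativeRing)

-- Determinants over a commutative ring

-- Congruences between integers cannot exclude `D r`: it is, for instance, 585 times 9 · 73^(r+1),
-- and both factors are 1 modulo 8. The obstruction is that π itself is 1 modulo 8 in ℤ[ω]. The
-- factor 3⁴ brings it out: 3 ramifies in ℤ[ω], so it divides s and N(π) together, and once the
-- primes above 73 are gone the residues modulo 8 would make π an associate of 3, which is never 1
-- modulo 8.
--
-- The groups part at the characters of order 4 and 12. On `E` all eight values lie in ℤ[C₃] and
-- agree modulo 2. On `G` values in ℤ[i] also occur, and they supply the primes 5 and 13 of `D r`
-- one at a time.
--
-- Everything is done with integer matrices. A cyclic factor of even order is split by sums and
-- differences of blocks, circulants of size three are norms, and the characters of order 4 and 12
-- are left inside one integer determinant that is evaluated only on explicit elements.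

module DeterminantProperties {c ℓ} (R : CommutativeRing c ℓ) where
  open import Data.Nat.Base using (zero; suc; _+_)
  open CommutativeRing R hiding (zero) renaming (_+_ to _⊹_; _*_ to _·_)
  open Determinant R using () renaming (det to detᴿ)
  open SumProperties semiring
  open Exp semiring using (_^_)
  open RingProperties ring using (-1*x≈-x)
  open ProductSolver *-commutativeMonoid using (solve; _⊜_) renaming (_⊕_ to infixl 7 _⊗_)
  open import Relation.Binary.Reasoning.Setoid setoid

  Matrix : ℕ → Set c
  Matrix n = Fin n → Fin n → Carrier

  sgn : ∀ {n} → Fin n → Carrier
  sgn j = (- 1#) ^ toℕ j

  minor : ∀ {n} → Matrix (suc n) → Fin (suc n) → Matrix n
  minor A j i k = A (suc i) (punchIn j k)

  laplace : ∀ {n} → Matrix (suc n) → Vector Carrier (suc n)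
  laplace A j = sgn j · A zero j · detᴿ (minor A j)

  sum-cong : ∀ {n} (f g : Vector Carrier n) → (∀ i → f i ≈ g i) → sum f ≈ sum g
  sum-cong f g = sum-cong-≋

  sum-zero : ∀ {n} (f : Vector Carrier n) → (∀ i → f i ≈ 0#) → sum f ≈ 0#
  sum-zero {n} f f≈0 = trans (sum-cong-≋ f≈0) (sum-replicate-zero n)

  sum-↑ : ∀ m {n} (f : Vector Carrier (m + n)) →
          sum f ≈ sum (λ i → f (i ↑ˡ n)) ⊹ sum (λ j → f (m ↑ʳ j))
  sum-↑ zero    f = sym (+-identityˡ _)
  sum-↑ (suc m) f = trans (+-congˡ (sum-↑ m (tail f))) (sym (+-assoc _ _ _))

  det-cong : ∀ {n} {A B : Matrix n} → (∀ i j → A i j ≈ B i j) → detᴿ A ≈ detᴿ B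
  det-cong {zero}  A≈B = refl
  det-cong {suc n} {A} {B} A≈B = sum-cong (laplace A) (laplace B) λ j →
    *-cong (*-congˡ (A≈B zero j)) (det-cong λ i k → A≈B (suc i) (punchIn j k))

  det-+-row : ∀ {n} (A B C : Matrix n) i → (∀ j → C i j ≈ A i j ⊹ B i j) →
              (∀ k → k ≢ i → ∀ j → C k j ≈ A k j) →
              (∀ k → k ≢ i → ∀ j → C k j ≈ B k j) →
              detᴿ C ≈ detᴿ A ⊹ detᴿ B
  det-+-row {suc n} A B C zero C≈A+B C≈A C≈B = trans (sum-cong (laplace C) (λ j → laplace A j ⊹ laplace B j) λ j → begin
    sgn j · C zero j · detᴿ (minor C j)
      ≈⟨ *-congʳ (*-congˡ (C≈A+B j)) ⟩
    sgn j · (A zero j ⊹ B zero j) · detᴿ (minor C j)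
      ≈⟨ trans (*-congʳ (distribˡ _ _ _)) (distribʳ _ _ _) ⟩
    sgn j · A zero j · detᴿ (minor C j) ⊹ sgn j · B zero j · detᴿ (minor C j)
      ≈⟨ +-cong (*-congˡ (det-cong λ i k → C≈A (suc i) (λ ()) (punchIn j k)))
                (*-congˡ (det-cong λ i k → C≈B (suc i) (λ ()) (punchIn j k))) ⟩
    sgn j · A zero j · detᴿ (minor A j) ⊹ sgn j · B zero j · detᴿ (minor B j)  ∎)
    (∑-distrib-+ (laplace A) (laplace B))
  det-+-row {suc n} A B C (suc i) C≈A+B C≈A C≈B = trans (sum-cong (laplace C) (λ j → laplace A j ⊹ laplace B j) λ j → begin
    sgn j · C zero j · detᴿ (minor C j)
      ≈⟨ *-congˡ (det-+-row (minor A j) (minor B j) (minor C j) i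
           (λ k → C≈A+B (punchIn j k))
           (λ k k≢i l → C≈A (suc k) (k≢i ∘ suc-injective) (punchIn j l))
           (λ k k≢i l → C≈B (suc k) (k≢i ∘ suc-injective) (punchIn j l))) ⟩
    sgn j · C zero j · (detᴿ (minor A j) ⊹ detᴿ (minor B j))
      ≈⟨ distribˡ _ _ _ ⟩
    sgn j · C zero j · detᴿ (minor A j) ⊹ sgn j · C zero j · detᴿ (minor B j)
      ≈⟨ +-cong (*-congʳ (*-congˡ (C≈A zero (λ ()) j))) (*-congʳ (*-congˡ (C≈B zero (λ ()) j))) ⟩
    sgn j · A zero j · detᴿ (minor A j) ⊹ sgn j · B zero j · detᴿ (minor B j)  ∎)
    (∑-distrib-+ (laplace A) (laplace B))

  -1*-1≈1 : - 1# · - 1# ≈ 1#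
  -1*-1≈1 = trans (-1*x≈-x (- 1#)) (RingProperties.-‿involutive ring 1#)

  -- The ordered pair (j , punchIn j k) of distinct columns is cancelled by the
  -- reversed pair. Pairs involving column zero are split off first, so that
  -- the others are pairs of the columns of a smaller instance.
  sum-pairs≈0 : ∀ n (φ : (Fin n → Fin (2 + n)) → Carrier) →
                (∀ {f g} → f ≗ g → φ f ≈ φ g) → (a : Vector Carrier (2 + n)) →
                sum (λ j → sgn j · a j ·
                  sum (λ k → sgn k · a (punchIn j k) · φ (punchIn j ∘ punchIn k))) ≈ 0#
  sum-pairs≈0 n φ φ-cong a = begin
    1# · a zero · sum p ⊹ sum (λ j → sgn (suc j) · b j · (q j ⊹ sum (r j)))
      ≈⟨ +-cong (*-distribˡ-sum (1# · a zero) p)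
           (trans (sum-cong _ (λ j → y j ⊹ z j) λ j → distribˡ (sgn (suc j) · b j) (q j) (sum (r j)))
                  (∑-distrib-+ y z)) ⟩
    sum x ⊹ (sum y ⊹ sum z)
      ≈⟨ +-assoc _ _ _ ⟨
    sum x ⊹ sum y ⊹ sum z
      ≈⟨ +-congʳ (∑-distrib-+ x y) ⟨
    sum (λ k → x k ⊹ y k) ⊹ sum z
      ≈⟨ +-cong (sum-zero _ cancel) (rest≈0 n φ φ-cong a) ⟩
    0# ⊹ 0#
      ≈⟨ +-identityˡ 0# ⟩
    0# ∎
    where
    b : Vector Carrier (suc n)
    b = tail a
    p q : Vector Carrier (suc n)
    p k = sgn k · b k · φ (suc ∘ punchIn k)
    q k = 1# · a zero · φ (suc ∘ punchIn k)
    r : Fin (suc n) → Vector Carrier n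
    r j k = sgn (suc k) · b (punchIn j k) · φ (punchIn (suc j) ∘ punchIn (suc k))

    x y z : Vector Carrier (suc n)
    x k = 1# · a zero · p k
    y k = sgn (suc k) · b k · q k
    z j = sgn (suc j) · b j · sum (r j)

    cancel : ∀ k → 1# · a zero · p k ⊹ sgn (suc k) · b k · q k ≈ 0#
    cancel k = begin
      1# · a zero · p k ⊹ sgn (suc k) · b k · q k
        ≈⟨ +-cong (solve 5 (λ o x s y d → o ⊗ x ⊗ (s ⊗ y ⊗ d) ⊜ o ⊗ (x ⊗ s ⊗ y ⊗ d)) refl 1# (a zero) (sgn k) (b k) w)
             (trans (*-congˡ (*-congʳ (*-identityˡ _)))
               (solve 5 (λ m s y x d → m ⊗ s ⊗ y ⊗ (x ⊗ d) ⊜ m ⊗ (x ⊗ s ⊗ y ⊗ d)) refl (- 1#) (sgn k) (b k) (a zero) w)) ⟩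
      1# · v ⊹ - 1# · v    ≈⟨ distribʳ v 1# (- 1#) ⟨
      (1# ⊹ - 1#) · v      ≈⟨ *-congʳ (-‿inverseʳ 1#) ⟩
      0# · v               ≈⟨ zeroˡ v ⟩
      0#                   ∎
      where
      w = φ (suc ∘ punchIn k)
      v = a zero · sgn k · b k · w

    rest≈0 : ∀ n (φ : (Fin n → Fin (2 + n)) → Carrier) →
             (∀ {f g} → f ≗ g → φ f ≈ φ g) → (a : Vector Carrier (2 + n)) →
             sum (λ j → sgn (suc j) · a (suc j) ·
               sum (λ k → sgn (suc k) · a (suc (punchIn j k)) · φ (punchIn (suc j) ∘ punchIn (suc k)))) ≈ 0#
    rest≈0 zero    φ φ-cong a = trans (+-identityʳ _) (zeroʳ _)
    rest≈0 (suc n) φ φ-cong a = trans (sum-cong _ (λ j → sgn j · a (suc j) · sum (t j)) λ j → begin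
      sgn (suc j) · a (suc j) · sum (λ k → sgn (suc k) · a (suc (punchIn j k)) · φ (punchIn (suc j) ∘ punchIn (suc k)))
        ≈⟨ *-congˡ (sum-cong _ (λ k → - 1# · t j k) λ k →
             trans (*-congˡ (φ-cong (lift-punchIn j k)))
               (solve 4 (λ m s x d → m ⊗ s ⊗ x ⊗ d ⊜ m ⊗ (s ⊗ x ⊗ d)) refl
                 (- 1#) (sgn k) (a (suc (punchIn j k))) (φ (lift 1 (punchIn j ∘ punchIn k))))) ⟩
      sgn (suc j) · a (suc j) · sum (λ k → - 1# · t j k)
        ≈⟨ *-congˡ (*-distribˡ-sum (- 1#) (t j)) ⟨
      sgn (suc j) · a (suc j) · (- 1# · sum (t j))
        ≈⟨ solve 4 (λ m s x d → m ⊗ s ⊗ x ⊗ (m ⊗ d) ⊜ m ⊗ m ⊗ (s ⊗ x ⊗ d)) refl (- 1#) (sgn j) (a (suc j)) (sum (t j)) ⟩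
      - 1# · - 1# · (sgn j · a (suc j) · sum (t j))
        ≈⟨ trans (*-congʳ -1*-1≈1) (*-identityˡ _) ⟩
      sgn j · a (suc j) · sum (t j)  ∎)
      (sum-pairs≈0 n (λ f → φ (lift 1 f)) (λ f≗g → φ-cong λ { zero → ≡.refl ; (suc l) → ≡.cong suc (f≗g l) }) (tail a))
      where
      lift-punchIn : ∀ j k → punchIn (suc j) ∘ punchIn (suc k) ≗ lift 1 (punchIn j ∘ punchIn k)
      lift-punchIn j k zero    = ≡.refl
      lift-punchIn j k (suc l) = ≡.refl
      t : Fin (suc (suc n)) → Vector Carrier (suc n)
      t j k = sgn k · a (suc (punchIn j k)) · φ (lift 1 (punchIn j ∘ punchIn k))

  -- A named property of one size, so that it can be handed over as the induction hypothesis about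
  -- minors.
  Alternating : ℕ → Set (c ⊔ ℓ)
  Alternating n = (A : Matrix n) → ∀ i j → i ≢ j → (∀ k → A i k ≈ A j k) → detᴿ A ≈ 0#

  det-equal-rows-suc : ∀ {n} → Alternating n → (A : Matrix (suc n)) → ∀ i j → i ≢ j →
                       (∀ k → A (suc i) k ≈ A (suc j) k) → detᴿ A ≈ 0#
  det-equal-rows-suc alt A i j i≢j eq = sum-zero (laplace A) λ k →
    trans (*-congˡ (alt (minor A k) i j i≢j (eq ∘ punchIn k))) (zeroʳ _)

  det-equal-rows-zero : ∀ {n} → Alternating n → (A : Matrix (suc n)) → ∀ j →
                        (∀ k → A zero k ≈ A (suc j) k) → detᴿ A ≈ 0#
  -- Expanding both equal rows gives a signed sum over ordered pairs of distinct columns, in which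
  -- the remaining rows see only the set of deleted columns.
  det-equal-rows-zero {suc n} alt A zero eq = trans
    (sum-cong (laplace A) _ λ j → *-congˡ (sum-cong (laplace (minor A j)) _ λ k →
      *-congʳ (*-congˡ (sym (eq (punchIn j k))))))
    (sum-pairs≈0 n (λ f → detᴿ λ i l → A (suc (suc i)) (f l))
      (λ f≗g → det-cong λ i l → reflexive (≡.cong (A (suc (suc i))) (f≗g l))) (A zero))
  -- Exchanging row 1 with row j only changes the sign, which reduces the claim
  -- to equal rows 0 and 1.
  det-equal-rows-zero {suc n} alt A (suc j) eq = begin
    detᴿ A                                  ≈⟨ det-cong (λ i k → reflexive (A≡M i k)) ⟩
    detᴿ (M u v)                            ≈⟨ +-identityʳ _ ⟨
    detᴿ (M u v) ⊹ 0#                       ≈⟨ +-congˡ (det-equal-rows-zero alt (M v u) zero eq) ⟨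
    detᴿ (M u v) ⊹ detᴿ (M v u)             ≈⟨ +-cong (+-identityˡ _) (+-identityʳ _) ⟨
    (0# ⊹ detᴿ (M u v)) ⊹ (detᴿ (M v u) ⊹ 0#)
      ≈⟨ +-cong (+-congʳ (M-diag u)) (+-congˡ (M-diag v)) ⟨
    (detᴿ (M u u) ⊹ detᴿ (M u v)) ⊹ (detᴿ (M v u) ⊹ detᴿ (M v v))
      ≈⟨ +-cong (M-+ʳ u) (M-+ʳ v) ⟨
    detᴿ (M u w) ⊹ detᴿ (M v w)
      ≈⟨ det-+-row (M u w) (M v w) (M w w) (suc zero) (λ _ → refl)
           (λ { zero _ _ → refl ; (suc zero) 1≢1 → contradiction ≡.refl 1≢1 ; (suc (suc _)) _ _ → refl })
           (λ { zero _ _ → refl ; (suc zero) 1≢1 → contradiction ≡.refl 1≢1 ; (suc (suc _)) _ _ → refl }) ⟨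
    detᴿ (M w w)                            ≈⟨ M-diag w ⟩
    0#                                      ∎
    where
    u v w : Vector Carrier (suc (suc n))
    u = A (suc zero)
    v = A (suc (suc j))
    w k = u k ⊹ v k
    T : Fin n → Vector Carrier (suc (suc n))
    T i = A (suc (suc i))
    M : (x y : Vector Carrier (suc (suc n))) → Matrix (suc (suc n))
    M x y zero          = A zero
    M x y (suc zero)    = x
    M x y (suc (suc i)) = updateAt T j (const y) i

    M-diag : ∀ x → detᴿ (M x x) ≈ 0#
    M-diag x = det-equal-rows-suc alt (M x x) zero (suc j) (λ ())
      λ k → reflexive (≡.cong-app (≡.sym (updateAt-updates j T)) k)

    M-+ʳ : ∀ x → detᴿ (M x w) ≈ detᴿ (M x u) ⊹ detᴿ (M x v)
    M-+ʳ x = det-+-row (M x u) (M x v) (M x w) (suc (suc j))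
      (λ k → trans (at w k) (sym (+-cong (at u k) (at v k)))) (off w u) (off w v)
      where
      at : ∀ y k → updateAt T j (const y) j k ≈ y k
      at y k = reflexive (≡.cong-app (updateAt-updates j T) k)
      off : ∀ y z i → i ≢ suc (suc j) → ∀ k → M x y i k ≈ M x z i k
      off y z zero          _   k = refl
      off y z (suc zero)    _   k = refl
      off y z (suc (suc i)) i≢j k = reflexive (≡.cong-app
        (≡.trans (updateAt-minimal i j T (i≢j ∘ ≡.cong (λ l → suc (suc l))))
          (≡.sym (updateAt-minimal i j T (i≢j ∘ ≡.cong (λ l → suc (suc l)))))) k)

    A≡M : ∀ i k → A i k ≡ M u v i k
    A≡M zero          k = ≡.refl
    A≡M (suc zero)    k = ≡.refl
    A≡M (suc (suc i)) k with i ≟ j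
    ... | yes ≡.refl = ≡.cong-app (≡.sym (updateAt-updates j T)) k
    ... | no  i≢j    = ≡.cong-app (≡.sym (updateAt-minimal i j T i≢j)) k

  det-equal-rows : ∀ {n} → Alternating n
  det-equal-rows {suc n} A zero    zero    0≢0 eq = contradiction ≡.refl 0≢0
  det-equal-rows {suc n} A zero    (suc j) i≢j eq = det-equal-rows-zero det-equal-rows A j eq
  det-equal-rows {suc n} A (suc i) zero    i≢j eq = det-equal-rows-zero det-equal-rows A i (sym ∘ eq)
  det-equal-rows {suc n} A (suc i) (suc j) i≢j eq = det-equal-rows-suc det-equal-rows A i j (i≢j ∘ ≡.cong suc) eq

  -- The corner term is common to both expansions. Every other minor of the first row still contains
  -- column zero; expanding it there by induction and exchanging the two sums regroups the terms by
  -- rows.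
  det-expand-column : ∀ {n} (A : Matrix (suc n)) →
    detᴿ A ≈ sum λ i → sgn i · A i zero · detᴿ (λ k l → A (punchIn i k) (suc l))
  det-expand-column {zero}  A = refl
  det-expand-column {suc n} A = +-congˡ (begin
    sum (λ j → sgn (suc j) · A zero (suc j) · detᴿ (minor A (suc j)))
      ≈⟨ sum-cong _ _ (λ j → trans (*-congˡ (det-expand-column (minor A (suc j))))
           (*-distribˡ-sum (sgn (suc j) · A zero (suc j)) (λ i → sgn i · A (suc i) zero · d i j))) ⟩
    sum (λ j → sum λ i → sgn (suc j) · A zero (suc j) · (sgn i · A (suc i) zero · d i j))
      ≈⟨ ∑-comm (λ j i → sgn (suc j) · A zero (suc j) · (sgn i · A (suc i) zero · d i j)) ⟩
    sum (λ i → sum λ j → sgn (suc j) · A zero (suc j) · (sgn i · A (suc i) zero · d i j))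
      ≈⟨ sum-cong _ _ (λ i → trans (sum-cong _ _ λ j →
           solve 6 (λ m s x t y z → m ⊗ s ⊗ x ⊗ (t ⊗ y ⊗ z) ⊜ m ⊗ t ⊗ y ⊗ (s ⊗ x ⊗ z)) refl
             (- 1#) (sgn j) (A zero (suc j)) (sgn i) (A (suc i) zero) (d i j))
           (sym (*-distribˡ-sum (sgn (suc i) · A (suc i) zero) (λ j → sgn j · A zero (suc j) · d i j)))) ⟩
    sum (λ i → sgn (suc i) · A (suc i) zero · detᴿ (λ k l → A (punchIn (suc i) k) (suc l)))  ∎)
    where
    d : Fin (suc n) → Fin (suc n) → Carrier
    d i j = detᴿ λ k l → A (suc (punchIn i k)) (suc (punchIn j l))

  det-transpose : ∀ {n} (A : Matrix n) → detᴿ (λ i j → A j i) ≈ detᴿ A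
  det-transpose {zero}  A = refl
  det-transpose {suc n} A = trans
    (sum-cong (laplace λ i j → A j i) _ λ j → *-congˡ (det-transpose λ i k → A (punchIn j i) (suc k)))
    (sym (det-expand-column A))

  det-add-row : ∀ {n} (A : Matrix n) {i j} → i ≢ j →
                detᴿ (updateAt A i (λ r k → r k ⊹ A j k)) ≈ detᴿ A
  det-add-row A {i} {j} i≢j = begin
    detᴿ (updateAt A i (λ r k → r k ⊹ A j k))
      ≈⟨ det-+-row A B A′ i (λ k → trans (≡⇒≈ (updateAt-updates i A) k)
           (+-congˡ (sym (≡⇒≈ (updateAt-updates i A) k))))
           (λ l l≢i → ≡⇒≈ (updateAt-minimal l i A l≢i))
           (λ l l≢i k → trans (≡⇒≈ (updateAt-minimal l i A l≢i) k)
              (sym (≡⇒≈ (updateAt-minimal l i A l≢i) k))) ⟩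
    detᴿ A ⊹ detᴿ B
      ≈⟨ +-congˡ (det-equal-rows B i j i≢j λ k → trans (≡⇒≈ (updateAt-updates i A) k)
           (sym (≡⇒≈ (updateAt-minimal j i A (i≢j ∘ ≡.sym)) k))) ⟩
    detᴿ A ⊹ 0#
      ≈⟨ +-identityʳ _ ⟩
    detᴿ A  ∎
    where
    B A′ : Matrix _
    B = updateAt A i (const (A j))
    A′ = updateAt A i (λ r k → r k ⊹ A j k)
    ≡⇒≈ : {x y : Vector Carrier _} → x ≡ y → ∀ k → x k ≈ y k
    ≡⇒≈ eq k = reflexive (≡.cong-app eq k)

  -- No source row `q j` is itself a target, so the simultaneous additions can be made one after
  -- another. `B` is described by its entries, so that block matrices fit directly.
  det-add-rows : ∀ {m n} (p q : Fin m → Fin n) → (∀ {i j} → p i ≡ p j → i ≡ j) → (∀ i j → p i ≢ q j) →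
                 {A B : Matrix n} → (∀ i k → B (p i) k ≈ A (p i) k ⊹ A (q i) k) →
                 (∀ r → (∀ i → r ≢ p i) → ∀ k → B r k ≈ A r k) → detᴿ B ≈ detᴿ A
  det-add-rows {zero}  p q p-inj p≢q new old = det-cong λ r → old r λ ()
  det-add-rows {suc m} {n} p q p-inj p≢q {A} {B} new old = trans
    (det-add-rows (p ∘ suc) (q ∘ suc) (suc-injective ∘ p-inj) (λ i j → p≢q (suc i) (suc j)) {A′}
      (λ i k → trans (new (suc i) k) (sym (+-cong
        (kept (p (suc i)) (λ eq → contradiction (p-inj eq) λ ()) k)
        (kept (q (suc i)) (p≢q zero (suc i) ∘ ≡.sym) k))))
      rest)
    (det-add-row A (p≢q zero zero))
    where
    A′ : Matrix n
    A′ = updateAt A (p zero) (λ r k → r k ⊹ A (q zero) k)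
    kept : ∀ r → r ≢ p zero → ∀ k → A′ r k ≈ A r k
    kept r r≢p k = reflexive (≡.cong-app (updateAt-minimal r (p zero) A r≢p) k)
    rest : ∀ r → (∀ i → r ≢ p (suc i)) → ∀ k → B r k ≈ A′ r k
    rest r r≢p k with r ≟ p zero
    ... | yes ≡.refl = trans (new zero k)
      (reflexive (≡.cong-app (≡.sym (updateAt-updates (p zero) A)) k))
    ... | no  r≢p₀   = trans (old r (λ { zero → r≢p₀ ; (suc i) → r≢p i }) k) (sym (kept r r≢p₀ k))

  punchIn-↑ˡ-↑ˡ : ∀ {m} n (j : Fin (suc m)) k → punchIn (j ↑ˡ n) (k ↑ˡ n) ≡ punchIn j k ↑ˡ n
  punchIn-↑ˡ-↑ˡ n zero    k       = ≡.refl
  punchIn-↑ˡ-↑ˡ n (suc j) zero    = ≡.refl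
  punchIn-↑ˡ-↑ˡ n (suc j) (suc k) = ≡.cong suc (punchIn-↑ˡ-↑ˡ n j k)

  punchIn-↑ˡ-↑ʳ : ∀ m {n} (j : Fin (suc m)) (k : Fin n) → punchIn (j ↑ˡ n) (m ↑ʳ k) ≡ suc m ↑ʳ k
  punchIn-↑ˡ-↑ʳ m       zero    k = ≡.refl
  punchIn-↑ˡ-↑ʳ (suc m) (suc j) k = ≡.cong suc (punchIn-↑ˡ-↑ʳ m j k)

  -- In the expansion along the first row the columns of the right block contribute zero, and
  -- deleting a column of the left block preserves the shape.
  det-block-triangular : ∀ m {n} (A : Matrix (m + n)) → (∀ i j → A (i ↑ˡ n) (m ↑ʳ j) ≈ 0#) →
    detᴿ A ≈ detᴿ (λ i j → A (i ↑ˡ n) (j ↑ˡ n)) · detᴿ (λ i j → A (m ↑ʳ i) (m ↑ʳ j))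
  det-block-triangular zero        A A≈0 = sym (*-identityˡ _)
  det-block-triangular (suc m) {n} A A≈0 = begin
    detᴿ A
      ≈⟨ sum-↑ (suc m) (laplace A) ⟩
    sum (λ j → sgn (j ↑ˡ n) · A zero (j ↑ˡ n) · detᴿ (minor A (j ↑ˡ n)))
      ⊹ sum (λ j → sgn (suc m ↑ʳ j) · A zero (suc m ↑ʳ j) · detᴿ (minor A (suc m ↑ʳ j)))
      ≈⟨ +-cong (sum-cong _ _ left) (sum-zero _ λ j →
           trans (*-congʳ (trans (*-congˡ (A≈0 zero j)) (zeroʳ _))) (zeroˡ _)) ⟩
    sum (λ j → sgn j · A zero (j ↑ˡ n) · detᴿ (minor X j) · detᴿ Y) ⊹ 0#
      ≈⟨ +-identityʳ _ ⟩
    sum (λ j → sgn j · A zero (j ↑ˡ n) · detᴿ (minor X j) · detᴿ Y)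
      ≈⟨ *-distribʳ-sum (detᴿ Y) (λ j → sgn j · A zero (j ↑ˡ n) · detᴿ (minor X j)) ⟨
    detᴿ X · detᴿ Y  ∎
    where
    X : Matrix (suc m)
    X i j = A (i ↑ˡ n) (j ↑ˡ n)
    Y : Matrix n
    Y i j = A (suc m ↑ʳ i) (suc m ↑ʳ j)
    left : ∀ j → sgn (j ↑ˡ n) · A zero (j ↑ˡ n) · detᴿ (minor A (j ↑ˡ n))
                 ≈ sgn j · A zero (j ↑ˡ n) · detᴿ (minor X j) · detᴿ Y
    left j = begin
      sgn (j ↑ˡ n) · A zero (j ↑ˡ n) · detᴿ (minor A (j ↑ˡ n))
        ≈⟨ *-cong (*-congʳ (reflexive (≡.cong ((- 1#) ^_) (toℕ-↑ˡ j n))))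
             (det-block-triangular m (minor A (j ↑ˡ n)) λ i k →
               trans (reflexive (≡.cong (A (suc i ↑ˡ n)) (punchIn-↑ˡ-↑ʳ m j k))) (A≈0 (suc i) k)) ⟩
      sgn j · A zero (j ↑ˡ n) · (detᴿ (λ i k → minor A (j ↑ˡ n) (i ↑ˡ n) (k ↑ˡ n))
        · detᴿ (λ i k → minor A (j ↑ˡ n) (m ↑ʳ i) (m ↑ʳ k)))
        ≈⟨ *-congˡ (*-cong
             (det-cong λ i k → reflexive (≡.cong (A (suc i ↑ˡ n)) (punchIn-↑ˡ-↑ˡ n j k)))
             (det-cong λ i k → reflexive (≡.cong (A (suc m ↑ʳ i)) (punchIn-↑ˡ-↑ʳ m j k)))) ⟩
      sgn j · A zero (j ↑ˡ n) · (detᴿ (minor X j) · detᴿ Y)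
        ≈⟨ *-assoc _ _ _ ⟨
      sgn j · A zero (j ↑ˡ n) · detᴿ (minor X j) · detᴿ Y  ∎

  ↑ˡ≢↑ʳ : ∀ {m n} (i : Fin m) (j : Fin n) → i ↑ˡ n ≢ m ↑ʳ j
  ↑ˡ≢↑ʳ {m} {n} i j eq with () ← ≡.trans (≡.sym (splitAt-↑ˡ m i n)) (≡.trans (≡.cong (splitAt m) eq) (splitAt-↑ʳ m n j))

  -- The substitution admits a lower block of propositionally equal size, as
  -- in the order 2 * n = n + (n + 0) of C 2 ×ᴳ H.
  det-two-blocks : ∀ {n m} (n≡m : n ≡ m) (A : Matrix (n + m)) →
    let l : Fin n → Fin (n + m)
        l i = i ↑ˡ m
        r : Fin n → Fin (n + m)
        r i = n ↑ʳ ≡.subst Fin n≡m i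
    in (∀ i j → A (r i) (r j) ≈ A (l i) (l j)) →
       (∀ i j → A (r i) (l j) ≈ A (l i) (r j)) →
       detᴿ A ≈ detᴿ (λ i j → A (l i) (l j) ⊹ A (l i) (r j)) · detᴿ (λ i j → A (l i) (l j) - A (l i) (r j))
  det-two-blocks {n} ≡.refl A rr≈ll rl≈lr = begin
    detᴿ A                    ≈⟨ det-add-rows l r (↑ˡ-injective n _ _) ↑ˡ≢↑ʳ Bl B-bottom ⟨
    detᴿ B                    ≈⟨ det-transpose B ⟨
    detᴿ (λ i j → B j i)      ≈⟨ det-add-rows r l (↑ʳ-injective n _ _) (λ i j → ↑ˡ≢↑ʳ j i ∘ ≡.sym) T-right T-left ⟩
    detᴿ (λ i j → T j i)      ≈⟨ det-transpose T ⟩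
    detᴿ T                    ≈⟨ det-block-triangular n T T-zero ⟩
    detᴿ (λ i j → T (l i) (l j)) · detᴿ (λ i j → T (r i) (r j))
      ≈⟨ *-cong (det-cong λ i j → trans (Tl (l i) j) (trans (Bl i (l j)) (+-congˡ (rl≈lr i j))))
                (det-cong λ i j → trans (Tr (r i) j) (+-cong (trans (Br i (r j)) (rr≈ll i j))
                                                        (-‿cong (trans (Br i (l j)) (rl≈lr i j))))) ⟩
    detᴿ (λ i j → A (l i) (l j) ⊹ A (l i) (r j)) · detᴿ (λ i j → A (l i) (l j) - A (l i) (r j))  ∎
    where
    l r : Fin n → Fin (n + n)
    l i = i ↑ˡ n
    r i = n ↑ʳ i
    -- With blocks P, Q over Q, P: `B` adds the lower rows to the upper ones, and `T` then subtracts
    -- the left columns from the right ones, leaving P + Q, 0 over Q, P - Q. The subtraction is read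
    -- backwards, as `B` arising from `T` by additions, so that `det-add-rows` covers it after
    -- transposition.
    B T : Matrix (n + n)
    B = (λ i k → A (l i) k ⊹ A (r i) k) ++ (λ i → A (r i))
    T x = (λ j → B x (l j)) ++ (λ j → B x (r j) - B x (l j))

    Bl : ∀ i k → B (l i) k ≈ A (l i) k ⊹ A (r i) k
    Bl i k = reflexive (≡.cong-app (lookup-++ˡ {m = n} _ _ i) k)
    Br : ∀ i k → B (r i) k ≈ A (r i) k
    Br i k = reflexive (≡.cong-app (lookup-++ʳ {m = n} _ _ i) k)
    Tl : ∀ x j → T x (l j) ≈ B x (l j)
    Tl x j = reflexive (lookup-++ˡ (λ j → B x (l j)) _ j)
    Tr : ∀ x j → T x (r j) ≈ B x (r j) - B x (l j)
    Tr x j = reflexive (lookup-++ʳ (λ j → B x (l j)) _ j)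

    r-of : ∀ x → (∀ i → x ≢ l i) → Σ[ j ∈ Fin n ] r j ≡ x
    r-of x x≢l with splitAt n x in eq
    ... | inj₁ i = contradiction (≡.sym (splitAt⁻¹-↑ˡ eq)) (x≢l i)
    ... | inj₂ j = j , splitAt⁻¹-↑ʳ eq
    l-of : ∀ x → (∀ i → x ≢ r i) → Σ[ j ∈ Fin n ] l j ≡ x
    l-of x x≢r with splitAt n x in eq
    ... | inj₁ j = j , splitAt⁻¹-↑ˡ eq
    ... | inj₂ i = contradiction (≡.sym (splitAt⁻¹-↑ʳ {n} eq)) (x≢r i)

    B-bottom : ∀ x → (∀ i → x ≢ l i) → ∀ k → B x k ≈ A x k
    B-bottom x x≢l k with j , ≡.refl ← r-of x x≢l = Br j k
    T-right : ∀ j x → B x (r j) ≈ T x (r j) ⊹ T x (l j)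
    T-right j x = sym (begin
      T x (r j) ⊹ T x (l j)                    ≈⟨ +-cong (Tr x j) (Tl x j) ⟩
      B x (r j) - B x (l j) ⊹ B x (l j)        ≈⟨ +-assoc _ _ _ ⟩
      B x (r j) ⊹ (- B x (l j) ⊹ B x (l j))    ≈⟨ +-congˡ (-‿inverseˡ _) ⟩
      B x (r j) ⊹ 0#                           ≈⟨ +-identityʳ _ ⟩
      B x (r j)                                ∎)
    T-left : ∀ y → (∀ i → y ≢ r i) → ∀ x → B x y ≈ T x y
    T-left y y≢r x with j , ≡.refl ← l-of y y≢r = sym (Tl x j)
    T-zero : ∀ i j → T (l i) (r j) ≈ 0#
    T-zero i j = begin
      T (l i) (r j)                                                      ≈⟨ Tr (l i) j ⟩
      B (l i) (r j) - B (l i) (l j)                                      ≈⟨ +-cong (Bl i (r j)) (-‿cong (Bl i (l j))) ⟩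
      (A (l i) (r j) ⊹ A (r i) (r j)) - (A (l i) (l j) ⊹ A (r i) (l j))  ≈⟨ +-congˡ (-‿cong (trans (+-comm _ _)
                                                                                (sym (+-cong (sym (rl≈lr i j)) (rr≈ll i j))))) ⟩
      (A (l i) (r j) ⊹ A (r i) (r j)) - (A (l i) (r j) ⊹ A (r i) (r j))  ≈⟨ -‿inverseʳ _ ⟩
      0#                                                                 ∎

-- Group determinants

open import Data.Integer.Base using (ℤ; +_; -[1+_]; -_; _+_; _*_; _-_; ∣_∣; 0ℤ; 1ℤ)
open Signed using (divides)
open ≡ using (refl; sym; trans; cong; cong₂; subst; isEquivalence; module ≡-Reasoning)
open DeterminantProperties ℤ.+-*-commutativeRing
open ≡-Reasoning

private
  variable
    c ℓ : Level

-- The factors belong to the two characters of `C 2`. The enumeration lists all `(0F , h)` before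
-- all `(1F , h)`, and 1 is its own inverse in `C 2`, so the matrix consists of two blocks, repeated
-- crosswise.
groupDeterminant-C₂× : (H : FiniteGroup 0ℓ 0ℓ) (a : Fin 2 × FiniteGroup.Carrier H → ℤ) →
  groupDeterminant {0ℓ} {0ℓ} (C 2 ×ᴳ H) a ≡
    groupDeterminant H (λ h → a (0F , h) + a (1F , h)) * groupDeterminant H (λ h → a (0F , h) - a (1F , h))
groupDeterminant-C₂× H a = begin
  det M
    ≡⟨ det-two-blocks n≡n+0 M
         (λ i j → trans (cong₂ f (el-r i) (el-r j)) (sym (cong₂ f (el-l i) (el-l j))))
         (λ i j → trans (cong₂ f (el-r i) (el-l j)) (sym (cong₂ f (el-l i) (el-r j)))) ⟩
  det (λ i j → M (l i) (l j) + M (l i) (r j)) * det (λ i j → M (l i) (l j) - M (l i) (r j))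
    ≡⟨ cong₂ _*_ (det-cong λ i j → cong₂ _+_ (cong₂ f (el-l i) (el-l j)) (cong₂ f (el-l i) (el-r j)))
                 (det-cong λ i j → cong₂ _-_ (cong₂ f (el-l i) (el-l j)) (cong₂ f (el-l i) (el-r j))) ⟩
  _ ∎
  where
  module H = FiniteGroup H
  module K = FiniteGroup (C 2 ×ᴳ H)
  n = H.order
  n≡n+0 : n ≡ n ℕ.+ 0
  n≡n+0 = sym (ℕ.+-identityʳ n)
  f : K.Carrier → K.Carrier → ℤ
  f x y = a (x K.∙ y K.⁻¹)
  M : Matrix (2 ℕ.* n)
  M i j = f (K.element i) (K.element j)
  l r : Fin n → Fin (2 ℕ.* n)
  l i = i ↑ˡ (n ℕ.+ 0)
  r i = n ↑ʳ subst Fin n≡n+0 i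

  toℕ-subst : ∀ {m k} (eq : m ≡ k) (i : Fin m) → toℕ (subst Fin eq i) ≡ toℕ i
  toℕ-subst refl i = refl

  el-combine : ∀ x i → K.element (combine x i) ≡ (x , H.element i)
  el-combine x i = cong (λ p → proj₁ p , H.element (proj₂ p)) (remQuot-combine x i)
  el-l : ∀ i → K.element (l i) ≡ (0F , H.element i)
  el-l = el-combine 0F
  el-r : ∀ i → K.element (r i) ≡ (1F , H.element i)
  el-r i = trans
    (cong (λ k → K.element (n ↑ʳ k)) (toℕ-injective (trans (toℕ-subst n≡n+0 i) (sym (toℕ-↑ˡ i 0)))))
    (el-combine 1F i)

groupDeterminant-cong : (H : FiniteGroup c ℓ) {a b : FiniteGroup.Carrier H → ℤ} →
                        (∀ h → a h ≡ b h) → groupDeterminant H a ≡ groupDeterminant H b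
groupDeterminant-cong H a≗b = det-cong λ i j → a≗b (element i ∙ element j ⁻¹)
  where open FiniteGroup H

matrix₃ : (a b c d e f g h i : ℤ) → Matrix 3
matrix₃ a b c d e f g h i 0F 0F = a
matrix₃ a b c d e f g h i 0F 1F = b
matrix₃ a b c d e f g h i 0F 2F = c
matrix₃ a b c d e f g h i 1F 0F = d
matrix₃ a b c d e f g h i 1F 1F = e
matrix₃ a b c d e f g h i 1F 2F = f
matrix₃ a b c d e f g h i 2F 0F = g
matrix₃ a b c d e f g h i 2F 1F = h
matrix₃ a b c d e f g h i 2F 2F = i

det-matrix₃ : ∀ a b c d e f g h i → det (matrix₃ a b c d e f g h i) ≡
  a * (e * i - f * h) - b * (d * i - f * g) + c * (d * h - e * g)
-- The left polynomial copies the Laplace expansion exactly as it unfolds, with the sign factors,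
-- the empty minors and the final zero of each sum.
det-matrix₃ = solve 9 (λ a b c d e f g h i →
    con (+ 1) :* a :* minor₂ e f h i :+
      (con (- + 1) :* b :* minor₂ d f g i :+ (con (+ 1) :* c :* minor₂ d e g h :+ con 0ℤ))
    := a :* (e :* i :- f :* h) :- b :* (d :* i :- f :* g) :+ c :* (d :* h :- e :* g)) refl
  where
  open +-*-Solver
  minor₂ : ∀ {n} (a b c d : Polynomial n) → Polynomial n
  minor₂ a b c d = con (+ 1) :* a :* (con (+ 1) :* d :* con (+ 1) :+ con 0ℤ) :+
                   (con (- + 1) :* b :* (con (+ 1) :* c :* con (+ 1) :+ con 0ℤ) :+ con 0ℤ)

-- The norm of x + y ω + z ω² from ℤ[C₃] to ℤ, that is, the product of its values at the three
-- characters of C₃.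
norm : ℤ → ℤ → ℤ → ℤ
norm x y z = x * x * x + y * y * y + z * z * z - + 3 * (x * y * z)

diff : ∀ n .{{_ : ℕ.NonZero n}} → Fin n → Fin n → Fin n
diff n i j = i ∙ j ⁻¹
  where open Group (cyclicGroup n)

-- C (n + n) split over its element n of order two: the characters sending it
-- to 1 are those of C n, the others give the twisted determinant.
module _ {n N : ℕ.ℕ} .{{_ : ℕ.NonZero n}} .{{_ : ℕ.NonZero N}} (n+n≡N : n ℕ.+ n ≡ N) where
  private
    l r : Fin n → Fin N
    l i = subst Fin n+n≡N (i ↑ˡ n)
    r i = subst Fin n+n≡N (n ↑ʳ i)

  fold : (Fin N → ℤ) → Fin n → ℤ
  fold a k = a (l k) + a (r k)

  twisted : (Fin N → ℤ) → Matrix n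
  twisted a i j = a (diff N (l i) (l j)) - a (diff N (l i) (r j))

  -- The disjunction records whether the subtraction i - j borrows: a borrow exchanges the two
  -- halves, which the sum in `fold` does not notice. As a decidable property it is settled by
  -- evaluation for the sizes 6 and 12.
  IsDouble : Set
  IsDouble = ∀ i j →
    diff N (r i) (r j) ≡ diff N (l i) (l j) ×
    diff N (r i) (l j) ≡ diff N (l i) (r j) ×
    (diff N (l i) (l j) ≡ l (diff n i j) × diff N (l i) (r j) ≡ r (diff n i j) ⊎
     diff N (l i) (l j) ≡ r (diff n i j) × diff N (l i) (r j) ≡ l (diff n i j))

  isDouble? : Dec IsDouble
  isDouble? = all? λ i → all? λ j →
    diff N (r i) (r j) ≟ diff N (l i) (l j) ×-dec
    diff N (r i) (l j) ≟ diff N (l i) (r j) ×-dec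
    (diff N (l i) (l j) ≟ l (diff n i j) ×-dec diff N (l i) (r j) ≟ r (diff n i j) ⊎-dec
     diff N (l i) (l j) ≟ r (diff n i j) ×-dec diff N (l i) (r j) ≟ l (diff n i j))

groupDeterminant-double : ∀ {n N} .{{_ : ℕ.NonZero n}} .{{_ : ℕ.NonZero N}} (n+n≡N : n ℕ.+ n ≡ N) →
  IsDouble n+n≡N → ∀ a → groupDeterminant (C N) a ≡ groupDeterminant (C n) (fold n+n≡N a) * det (twisted n+n≡N a)
groupDeterminant-double {n} {N} refl double a = begin
  groupDeterminant (C N) a
    ≡⟨ det-two-blocks refl (λ i j → a (diff N i j)) (λ i j → cong a (proj₁ (double i j)))
         (λ i j → cong a (proj₁ (proj₂ (double i j)))) ⟩
  det (λ i j → a (diff N (l i) (l j)) + a (diff N (l i) (r j))) * det (twisted refl a)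
    ≡⟨ cong (_* det (twisted refl a)) (det-cong λ i j → entry i j (proj₂ (proj₂ (double i j)))) ⟩
  groupDeterminant (C n) (fold refl a) * det (twisted refl a)  ∎
  where
  l r : Fin n → Fin (n ℕ.+ n)
  l i = i ↑ˡ n
  r i = n ↑ʳ i
  entry : ∀ i j →
    (diff N (l i) (l j) ≡ l (diff n i j) × diff N (l i) (r j) ≡ r (diff n i j) ⊎
     diff N (l i) (l j) ≡ r (diff n i j) × diff N (l i) (r j) ≡ l (diff n i j)) →
    a (diff N (l i) (l j)) + a (diff N (l i) (r j)) ≡ fold refl a (diff n i j)
  entry i j (inj₁ (p , q)) = cong₂ (λ x y → a x + a y) p q
  entry i j (inj₂ (p , q)) = trans (cong₂ (λ x y → a x + a y) p q)
                                   (ℤ.+-comm (a (r (diff n i j))) (a (l (diff n i j))))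

groupDeterminant-C₃ : ∀ a → groupDeterminant (C 3) a ≡ norm (a 0F) (a 1F) (a 2F)
groupDeterminant-C₃ a = begin
  groupDeterminant (C 3) a
    ≡⟨ det-cong entry ⟩
  det (matrix₃ (a 0F) (a 2F) (a 1F) (a 1F) (a 0F) (a 2F) (a 2F) (a 1F) (a 0F))
    ≡⟨ det-matrix₃ (a 0F) (a 2F) (a 1F) (a 1F) (a 0F) (a 2F) (a 2F) (a 1F) (a 0F) ⟩
  _
    ≡⟨ circulant (a 0F) (a 1F) (a 2F) ⟩
  norm (a 0F) (a 1F) (a 2F)  ∎
  where
  entry : ∀ i j → a (diff 3 i j) ≡ matrix₃ (a 0F) (a 2F) (a 1F) (a 1F) (a 0F) (a 2F) (a 2F) (a 1F) (a 0F) i j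
  entry 0F 0F = refl
  entry 0F 1F = refl
  entry 0F 2F = refl
  entry 1F 0F = refl
  entry 1F 1F = refl
  entry 1F 2F = refl
  entry 2F 0F = refl
  entry 2F 1F = refl
  entry 2F 2F = refl
  circulant : ∀ x y z →
    x * (x * x - z * y) - z * (y * x - z * z) + y * (y * y - x * z) ≡
    x * x * x + y * y * y + z * z * z - + 3 * (x * y * z)
  circulant = solve-∀

-- The matrix is a skew circulant, for a generator with cube -1. Replacing the generator by its
-- negative makes it a circulant and reverses the sign of the middle argument.
det-twisted₃ : ∀ a → det (twisted {3} {6} refl a) ≡ norm (a 0F - a 3F) (a 4F - a 1F) (a 2F - a 5F)
det-twisted₃ a = begin
  det (twisted {3} {6} refl a)
    ≡⟨ det-cong entry ⟩
  det (matrix₃ (a 0F - a 3F) (a 5F - a 2F) (a 4F - a 1F)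
               (a 1F - a 4F) (a 0F - a 3F) (a 5F - a 2F)
               (a 2F - a 5F) (a 1F - a 4F) (a 0F - a 3F))
    ≡⟨ det-matrix₃ (a 0F - a 3F) (a 5F - a 2F) (a 4F - a 1F)
                   (a 1F - a 4F) (a 0F - a 3F) (a 5F - a 2F)
                   (a 2F - a 5F) (a 1F - a 4F) (a 0F - a 3F) ⟩
  _
    ≡⟨ skew (a 0F) (a 1F) (a 2F) (a 3F) (a 4F) (a 5F) ⟩
  norm (a 0F - a 3F) (a 4F - a 1F) (a 2F - a 5F)  ∎
  where
  entry : ∀ i j → twisted {3} {6} refl a i j ≡
    matrix₃ (a 0F - a 3F) (a 5F - a 2F) (a 4F - a 1F)
            (a 1F - a 4F) (a 0F - a 3F) (a 5F - a 2F)
            (a 2F - a 5F) (a 1F - a 4F) (a 0F - a 3F) i j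
  entry 0F 0F = refl
  entry 0F 1F = refl
  entry 0F 2F = refl
  entry 1F 0F = refl
  entry 1F 1F = refl
  entry 1F 2F = refl
  entry 2F 0F = refl
  entry 2F 1F = refl
  entry 2F 2F = refl
  skew : ∀ a b c d e f →
    (a - d) * ((a - d) * (a - d) - (f - c) * (b - e)) -
    (f - c) * ((b - e) * (a - d) - (f - c) * (c - f)) +
    (e - b) * ((b - e) * (b - e) - (a - d) * (c - f)) ≡
    (a - d) * (a - d) * (a - d) + (e - b) * (e - b) * (e - b) + (c - f) * (c - f) * (c - f) -
    + 3 * ((a - d) * (e - b) * (c - f))
  skew = solve-∀

isDouble₆ : IsDouble {3} {6} refl
isDouble₆ = from-yes (isDouble? {3} {6} refl)

isDouble₁₂ : IsDouble {6} {12} refl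
isDouble₁₂ = from-yes (isDouble? {6} {12} refl)

groupDeterminant-C₆ : ∀ a → groupDeterminant (C 6) a ≡
  norm (a 0F + a 3F) (a 1F + a 4F) (a 2F + a 5F) * norm (a 0F - a 3F) (a 4F - a 1F) (a 2F - a 5F)
groupDeterminant-C₆ a = trans (groupDeterminant-double {3} {6} refl isDouble₆ a)
  (cong₂ _*_ (groupDeterminant-C₃ (fold {3} {6} refl a)) (det-twisted₃ a))

groupDeterminant-C₁₂ : ∀ a →
  groupDeterminant (C 12) a ≡ groupDeterminant (C 6) (fold {6} {12} refl a) * det (twisted {6} {12} refl a)
groupDeterminant-C₁₂ = groupDeterminant-double {6} {12} refl isDouble₁₂

-- The group ring of C₃

-- ⟨ x , y , z ⟩ stands for x + y ω + z ω² in ℤ[C₃], where ω generates C₃.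
data ℤ[C₃] : Set where
  ⟨_,_,_⟩ : ℤ → ℤ → ℤ → ℤ[C₃]

infixl 6 _⊕_
infixl 7 _⊗_
infix 8 ⊖_

_⊕_ _⊗_ : ℤ[C₃] → ℤ[C₃] → ℤ[C₃]
⟨ x , y , z ⟩ ⊕ ⟨ x′ , y′ , z′ ⟩ = ⟨ x + x′ , y + y′ , z + z′ ⟩
⟨ x , y , z ⟩ ⊗ ⟨ x′ , y′ , z′ ⟩ =
  ⟨ x * x′ + y * z′ + z * y′ , x * y′ + y * x′ + z * z′ , x * z′ + y * y′ + z * x′ ⟩

⊖_ : ℤ[C₃] → ℤ[C₃]
⊖ ⟨ x , y , z ⟩ = ⟨ - x , - y , - z ⟩

0# 1# : ℤ[C₃]
0# = ⟨ 0ℤ , 0ℤ , 0ℤ ⟩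
1# = ⟨ 1ℤ , 0ℤ , 0ℤ ⟩

coeff₀ coeff₁ coeff₂ : ℤ[C₃] → ℤ
coeff₀ ⟨ x , y , z ⟩ = x
coeff₁ ⟨ x , y , z ⟩ = y
coeff₂ ⟨ x , y , z ⟩ = z

coeffs-injective : ∀ p q → coeff₀ p ≡ coeff₀ q → coeff₁ p ≡ coeff₁ q → coeff₂ p ≡ coeff₂ q → p ≡ q
coeffs-injective ⟨ x , y , z ⟩ ⟨ .x , .y , .z ⟩ refl refl refl = refl

⊕-assoc : ∀ p q r → (p ⊕ q) ⊕ r ≡ p ⊕ (q ⊕ r)
⊕-assoc p@(⟨ a , b , c ⟩) q@(⟨ d , e , f ⟩) r@(⟨ g , h , i ⟩) =
  coeffs-injective ((p ⊕ q) ⊕ r) (p ⊕ (q ⊕ r)) (ℤ.+-assoc a d g) (ℤ.+-assoc b e h) (ℤ.+-assoc c f i)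

⊕-comm : ∀ p q → p ⊕ q ≡ q ⊕ p
⊕-comm p@(⟨ a , b , c ⟩) q@(⟨ d , e , f ⟩) =
  coeffs-injective (p ⊕ q) (q ⊕ p) (ℤ.+-comm a d) (ℤ.+-comm b e) (ℤ.+-comm c f)

⊕-identityˡ : ∀ p → 0# ⊕ p ≡ p
⊕-identityˡ p@(⟨ a , b , c ⟩) =
  coeffs-injective (0# ⊕ p) p (ℤ.+-identityˡ a) (ℤ.+-identityˡ b) (ℤ.+-identityˡ c)

⊖-inverseˡ : ∀ p → ⊖ p ⊕ p ≡ 0#
⊖-inverseˡ p@(⟨ a , b , c ⟩) =
  coeffs-injective (⊖ p ⊕ p) 0# (ℤ.+-inverseˡ a) (ℤ.+-inverseˡ b) (ℤ.+-inverseˡ c)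

⊗-comm : ∀ p q → p ⊗ q ≡ q ⊗ p
⊗-comm p q = coeffs-injective (p ⊗ q) (q ⊗ p) (c₀ p q) (c₁ p q) (c₂ p q)
  where
  l₀ : ∀ a b c d e f → a * d + b * f + c * e ≡ d * a + e * c + f * b
  l₀ = solve-∀
  l₁ : ∀ a b c d e f → a * e + b * d + c * f ≡ d * b + e * a + f * c
  l₁ = solve-∀
  l₂ : ∀ a b c d e f → a * f + b * e + c * d ≡ d * c + e * b + f * a
  l₂ = solve-∀
  c₀ : ∀ p q → coeff₀ (p ⊗ q) ≡ coeff₀ (q ⊗ p)
  c₀ ⟨ a , b , c ⟩ ⟨ d , e , f ⟩ = l₀ a b c d e f
  c₁ : ∀ p q → coeff₁ (p ⊗ q) ≡ coeff₁ (q ⊗ p)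
  c₁ ⟨ a , b , c ⟩ ⟨ d , e , f ⟩ = l₁ a b c d e f
  c₂ : ∀ p q → coeff₂ (p ⊗ q) ≡ coeff₂ (q ⊗ p)
  c₂ ⟨ a , b , c ⟩ ⟨ d , e , f ⟩ = l₂ a b c d e f

⊗-identityˡ : ∀ p → 1# ⊗ p ≡ p
⊗-identityˡ p@(⟨ a , b , c ⟩) =
  coeffs-injective (1# ⊗ p) p (l a b c) (l b c a) (l c a b)
  where
  l : ∀ a b c → 1ℤ * a + 0ℤ * c + 0ℤ * b ≡ a
  l = solve-∀

⊗-assoc : ∀ p q r → (p ⊗ q) ⊗ r ≡ p ⊗ (q ⊗ r)
⊗-assoc p q r = coeffs-injective ((p ⊗ q) ⊗ r) (p ⊗ (q ⊗ r)) (c₀ p q r) (c₁ p q r) (c₂ p q r)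
  where
  l₀ : ∀ a b c d e f g h i →
    (a * d + b * f + c * e) * g + (a * e + b * d + c * f) * i + (a * f + b * e + c * d) * h ≡
    a * (d * g + e * i + f * h) + b * (d * i + e * h + f * g) + c * (d * h + e * g + f * i)
  l₀ = solve-∀
  l₁ : ∀ a b c d e f g h i →
    (a * d + b * f + c * e) * h + (a * e + b * d + c * f) * g + (a * f + b * e + c * d) * i ≡
    a * (d * h + e * g + f * i) + b * (d * g + e * i + f * h) + c * (d * i + e * h + f * g)
  l₁ = solve-∀
  l₂ : ∀ a b c d e f g h i →
    (a * d + b * f + c * e) * i + (a * e + b * d + c * f) * h + (a * f + b * e + c * d) * g ≡
    a * (d * i + e * h + f * g) + b * (d * h + e * g + f * i) + c * (d * g + e * i + f * h)
  l₂ = solve-∀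
  c₀ : ∀ p q r → coeff₀ ((p ⊗ q) ⊗ r) ≡ coeff₀ (p ⊗ (q ⊗ r))
  c₀ ⟨ a , b , c ⟩ ⟨ d , e , f ⟩ ⟨ g , h , i ⟩ = l₀ a b c d e f g h i
  c₁ : ∀ p q r → coeff₁ ((p ⊗ q) ⊗ r) ≡ coeff₁ (p ⊗ (q ⊗ r))
  c₁ ⟨ a , b , c ⟩ ⟨ d , e , f ⟩ ⟨ g , h , i ⟩ = l₁ a b c d e f g h i
  c₂ : ∀ p q r → coeff₂ ((p ⊗ q) ⊗ r) ≡ coeff₂ (p ⊗ (q ⊗ r))
  c₂ ⟨ a , b , c ⟩ ⟨ d , e , f ⟩ ⟨ g , h , i ⟩ = l₂ a b c d e f g h i

⊗-distribˡ-⊕ : ∀ p q r → p ⊗ (q ⊕ r) ≡ (p ⊗ q) ⊕ (p ⊗ r)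
⊗-distribˡ-⊕ p q r = coeffs-injective (p ⊗ (q ⊕ r)) ((p ⊗ q) ⊕ (p ⊗ r)) (c₀ p q r) (c₁ p q r) (c₂ p q r)
  where
  l : ∀ a b c d e f g h i →
    a * (d + g) + b * (e + h) + c * (f + i) ≡ (a * d + b * e + c * f) + (a * g + b * h + c * i)
  l = solve-∀
  c₀ : ∀ p q r → coeff₀ (p ⊗ (q ⊕ r)) ≡ coeff₀ ((p ⊗ q) ⊕ (p ⊗ r))
  c₀ ⟨ a , b , c ⟩ ⟨ d , e , f ⟩ ⟨ g , h , i ⟩ = l a b c d f e g i h
  c₁ : ∀ p q r → coeff₁ (p ⊗ (q ⊕ r)) ≡ coeff₁ ((p ⊗ q) ⊕ (p ⊗ r))
  c₁ ⟨ a , b , c ⟩ ⟨ d , e , f ⟩ ⟨ g , h , i ⟩ = l a b c e d f h g i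
  c₂ : ∀ p q r → coeff₂ (p ⊗ (q ⊕ r)) ≡ coeff₂ ((p ⊗ q) ⊕ (p ⊗ r))
  c₂ ⟨ a , b , c ⟩ ⟨ d , e , f ⟩ ⟨ g , h , i ⟩ = l a b c f e d i h g

ℤ[C₃]-commutativeRing : CommutativeRing 0ℓ 0ℓ
ℤ[C₃]-commutativeRing = record
  { Carrier = ℤ[C₃]
  ; _≈_ = _≡_
  ; _+_ = _⊕_
  ; _*_ = _⊗_
  ; -_ = ⊖_
  ; 0# = 0#
  ; 1# = 1#
  ; isCommutativeRing = record
    { isRing = record
      { +-isAbelianGroup = record
        { isGroup = record
          { isMonoid = record
            { isSemigroup = record
              { isMagma = record { isEquivalence = isEquivalence ; ∙-cong = cong₂ _⊕_ }
              ; assoc = ⊕-assoc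
              }
            ; identity = ⊕-identityˡ , λ p → trans (⊕-comm p 0#) (⊕-identityˡ p)
            }
          ; inverse = ⊖-inverseˡ , λ p → trans (⊕-comm p (⊖ p)) (⊖-inverseˡ p)
          ; ⁻¹-cong = cong ⊖_
          }
        ; comm = ⊕-comm
        }
      ; *-cong = cong₂ _⊗_
      ; *-assoc = ⊗-assoc
      ; *-identity = ⊗-identityˡ , λ p → trans (⊗-comm p 1#) (⊗-identityˡ p)
      ; distrib = ⊗-distribˡ-⊕ , λ p q r →
          trans (⊗-comm (q ⊕ r) p) (trans (⊗-distribˡ-⊕ p q r) (cong₂ _⊕_ (⊗-comm p q) (⊗-comm p r)))
      }
    ; *-comm = ⊗-comm
    }
  }

ℤ[C₃]-ring : AlmostCommutativeRing 0ℓ 0ℓ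
ℤ[C₃]-ring = fromCommutativeRing ℤ[C₃]-commutativeRing
  λ { ⟨ + 0 , + 0 , + 0 ⟩ → just refl ; _ → nothing }

N : ℤ[C₃] → ℤ
N ⟨ x , y , z ⟩ = norm x y z

N-⊗ : ∀ p q → N (p ⊗ q) ≡ N p * N q
N-⊗ ⟨ a , b , c ⟩ ⟨ d , e , f ⟩ = l a b c d e f
  where
  l : ∀ a b c d e f →
    let x = a * d + b * f + c * e
        y = a * e + b * d + c * f
        z = a * f + b * e + c * d
    in x * x * x + y * y * y + z * z * z - + 3 * (x * y * z) ≡
       (a * a * a + b * b * b + c * c * c - + 3 * (a * b * c)) *
       (d * d * d + e * e * e + f * f * f - + 3 * (d * e * f))
  l = solve-∀

2# 4# 8# : ℤ[C₃]
2# = ⟨ + 2 , + 0 , + 0 ⟩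
4# = ⟨ + 4 , + 0 , + 0 ⟩
8# = ⟨ + 8 , + 0 , + 0 ⟩

conjugate-product : ∀ s d →
  (1# ⊕ 2# ⊗ (s ⊕ d)) ⊗ (1# ⊕ 2# ⊗ (s ⊕ ⊖ d)) ≡ 1# ⊕ 4# ⊗ (s ⊕ s ⊗ s ⊕ ⊖ (d ⊗ d))
conjugate-product = solve-∀-over ℤ[C₃]-ring

-- The product is 1 + 4 (p + p′) modulo 16, and p + p′ is even.
product-≡1[8] : ∀ u q₁ q₂ q₃ → ∃[ m ]
  ((1# ⊕ 2# ⊗ (u ⊕ q₁ ⊕ (q₂ ⊕ q₃))) ⊗ (1# ⊕ 2# ⊗ (u ⊕ q₁ ⊕ ⊖ (q₂ ⊕ q₃)))) ⊗
  ((1# ⊕ 2# ⊗ (u ⊕ ⊖ q₁ ⊕ (q₂ ⊕ ⊖ q₃))) ⊗ (1# ⊕ 2# ⊗ (u ⊕ ⊖ q₁ ⊕ ⊖ (q₂ ⊕ ⊖ q₃)))) ≡ 1# ⊕ 8# ⊗ m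
product-≡1[8] u q₁ q₂ q₃ = r ⊕ 2# ⊗ (p ⊗ p′) , (begin
  _
    ≡⟨ cong₂ _⊗_ (conjugate-product (u ⊕ q₁) (q₂ ⊕ q₃)) (conjugate-product (u ⊕ ⊖ q₁) (q₂ ⊕ ⊖ q₃)) ⟩
  (1# ⊕ 4# ⊗ p) ⊗ (1# ⊕ 4# ⊗ p′)
    ≡⟨ expand p p′ ⟩
  1# ⊕ (4# ⊗ (p ⊕ p′) ⊕ 8# ⊗ (2# ⊗ (p ⊗ p′)))
    ≡⟨ cong (λ s → 1# ⊕ (4# ⊗ s ⊕ 8# ⊗ (2# ⊗ (p ⊗ p′)))) (even u q₁ q₂ q₃) ⟩
  1# ⊕ (4# ⊗ (2# ⊗ r) ⊕ 8# ⊗ (2# ⊗ (p ⊗ p′)))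
    ≡⟨ collect r (2# ⊗ (p ⊗ p′)) ⟩
  1# ⊕ 8# ⊗ (r ⊕ 2# ⊗ (p ⊗ p′)) ∎)
  where
  p p′ r : ℤ[C₃]
  p  = (u ⊕ q₁) ⊕ (u ⊕ q₁) ⊗ (u ⊕ q₁) ⊕ ⊖ ((q₂ ⊕ q₃) ⊗ (q₂ ⊕ q₃))
  p′ = (u ⊕ ⊖ q₁) ⊕ (u ⊕ ⊖ q₁) ⊗ (u ⊕ ⊖ q₁) ⊕ ⊖ ((q₂ ⊕ ⊖ q₃) ⊗ (q₂ ⊕ ⊖ q₃))
  r  = u ⊕ u ⊗ u ⊕ q₁ ⊗ q₁ ⊕ ⊖ (q₂ ⊗ q₂) ⊕ ⊖ (q₃ ⊗ q₃)
  expand : ∀ p q → (1# ⊕ 4# ⊗ p) ⊗ (1# ⊕ 4# ⊗ q) ≡ 1# ⊕ (4# ⊗ (p ⊕ q) ⊕ 8# ⊗ (2# ⊗ (p ⊗ q)))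
  expand = solve-∀-over ℤ[C₃]-ring
  collect : ∀ p q → 1# ⊕ (4# ⊗ (2# ⊗ p) ⊕ 8# ⊗ q) ≡ 1# ⊕ 8# ⊗ (p ⊕ q)
  collect = solve-∀-over ℤ[C₃]-ring
  even : ∀ u q₁ q₂ q₃ →
    (u ⊕ q₁) ⊕ (u ⊕ q₁) ⊗ (u ⊕ q₁) ⊕ ⊖ ((q₂ ⊕ q₃) ⊗ (q₂ ⊕ q₃)) ⊕
    ((u ⊕ ⊖ q₁) ⊕ (u ⊕ ⊖ q₁) ⊗ (u ⊕ ⊖ q₁) ⊕ ⊖ ((q₂ ⊕ ⊖ q₃) ⊗ (q₂ ⊕ ⊖ q₃))) ≡
    2# ⊗ (u ⊕ u ⊗ u ⊕ q₁ ⊗ q₁ ⊕ ⊖ (q₂ ⊗ q₂) ⊕ ⊖ (q₃ ⊗ q₃))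
  even = solve-∀-over ℤ[C₃]-ring

-- Values at the characters of C₂³

data Sign : Set where
  ⁺ ⁻ : Sign

_⊕[_]_ : ℤ[C₃] → Sign → ℤ[C₃] → ℤ[C₃]
p ⊕[ ⁺ ] q = p ⊕ q
p ⊕[ ⁻ ] q = p ⊕ ⊖ q

-- The values of an element of ℤ[C₃][C₂³] at the characters of C₂³. The indices
-- 0, …, 7 list the elements of C₂³ in binary, the first factor varying fastest.
value : (Fin 8 → ℤ[C₃]) → Sign → Sign → Sign → ℤ[C₃]
value a r s t =
  ((a 0F ⊕[ r ] a 1F) ⊕[ s ] (a 2F ⊕[ r ] a 3F)) ⊕[ t ] ((a 4F ⊕[ r ] a 5F) ⊕[ s ] (a 6F ⊕[ r ] a 7F))

value-pair : (Fin 8 → ℤ[C₃]) → Sign → Sign → ℤ[C₃]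
value-pair a r s = value a r s ⁺ ⊗ value a r s ⁻

value-product : (Fin 8 → ℤ[C₃]) → ℤ[C₃]
value-product a = (value-pair a ⁺ ⁺ ⊗ value-pair a ⁺ ⁻) ⊗ (value-pair a ⁻ ⁺ ⊗ value-pair a ⁻ ⁻)

-- Reversing the last sign negates the terms 4 to 7, so each pair of values multiplies to a
-- difference of squares `T` + 2 (± `q₁` ± `q₂` ± `q₃`). The same `T` occurs in all four pairs, and
-- the signs are the patterns with an even number of minus signs. `T` is congruent modulo 2 to the
-- square of the trivial value, hence of the form 1 + 2 `u`.
value-product-≡1[8] : ∀ a t → value a ⁺ ⁺ ⁺ ≡ 1# ⊕ 2# ⊗ t → ∃[ m ] value-product a ≡ 1# ⊕ 8# ⊗ m
value-product-≡1[8] a t value≡1+2t =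
  let m , product≡1+8m = product-≡1[8] u q₁ q₂ q₃ in m , (begin
  value-product a
    ≡⟨ cong₂ _⊗_
         (cong₂ _⊗_
           (pair q₁ (q₂ ⊕ q₃) (pair₊₊ (a 0F) (a 1F) (a 2F) (a 3F) (a 4F) (a 5F) (a 6F) (a 7F)))
           (pair q₁ (⊖ (q₂ ⊕ q₃)) (pair₊₋ (a 0F) (a 1F) (a 2F) (a 3F) (a 4F) (a 5F) (a 6F) (a 7F))))
         (cong₂ _⊗_
           (pair (⊖ q₁) (q₂ ⊕ ⊖ q₃) (pair₋₊ (a 0F) (a 1F) (a 2F) (a 3F) (a 4F) (a 5F) (a 6F) (a 7F)))
           (pair (⊖ q₁) (⊖ (q₂ ⊕ ⊖ q₃)) (pair₋₋ (a 0F) (a 1F) (a 2F) (a 3F) (a 4F) (a 5F) (a 6F) (a 7F)))) ⟩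
  _
    ≡⟨ product≡1+8m ⟩
  1# ⊕ 8# ⊗ m  ∎)
  where
  T B w u q₁ q₂ q₃ : ℤ[C₃]
  T  = (a 0F ⊗ a 0F ⊕ a 1F ⊗ a 1F ⊕ a 2F ⊗ a 2F ⊕ a 3F ⊗ a 3F ⊕
        ⊖ (a 4F ⊗ a 4F ⊕ a 5F ⊗ a 5F ⊕ a 6F ⊗ a 6F ⊕ a 7F ⊗ a 7F))
  B  = a 4F ⊕ a 5F ⊕ a 6F ⊕ a 7F
  w  = (a 4F ⊗ a 5F ⊕ a 4F ⊗ a 6F ⊕ a 4F ⊗ a 7F ⊕ a 5F ⊗ a 6F ⊕ a 5F ⊗ a 7F ⊕ a 6F ⊗ a 7F ⊕
        ⊖ (a 0F ⊗ a 1F ⊕ a 0F ⊗ a 2F ⊕ a 0F ⊗ a 3F ⊕ a 1F ⊗ a 2F ⊕ a 1F ⊗ a 3F ⊕ a 2F ⊗ a 3F))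
  u  = t ⊕ (t ⊕ ⊖ B) ⊕ 2# ⊗ (t ⊗ (t ⊕ ⊖ B)) ⊕ w
  q₁ = (a 0F ⊗ a 1F ⊕ a 2F ⊗ a 3F ⊕ ⊖ (a 4F ⊗ a 5F ⊕ a 6F ⊗ a 7F))
  q₂ = (a 0F ⊗ a 2F ⊕ a 1F ⊗ a 3F ⊕ ⊖ (a 4F ⊗ a 6F ⊕ a 5F ⊗ a 7F))
  q₃ = (a 0F ⊗ a 3F ⊕ a 1F ⊗ a 2F ⊕ ⊖ (a 4F ⊗ a 7F ⊕ a 5F ⊗ a 6F))
  pair₊₊ : ∀ a b c d e f g h →
    (((a ⊕ b) ⊕ (c ⊕ d)) ⊕ ((e ⊕ f) ⊕ (g ⊕ h))) ⊗
    (((a ⊕ b) ⊕ (c ⊕ d)) ⊕ ⊖ ((e ⊕ f) ⊕ (g ⊕ h))) ≡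
    (a ⊗ a ⊕ b ⊗ b ⊕ c ⊗ c ⊕ d ⊗ d ⊕ ⊖ (e ⊗ e ⊕ f ⊗ f ⊕ g ⊗ g ⊕ h ⊗ h)) ⊕
    2# ⊗ ((a ⊗ b ⊕ c ⊗ d ⊕ ⊖ (e ⊗ f ⊕ g ⊗ h)) ⊕
          ((a ⊗ c ⊕ b ⊗ d ⊕ ⊖ (e ⊗ g ⊕ f ⊗ h)) ⊕ (a ⊗ d ⊕ b ⊗ c ⊕ ⊖ (e ⊗ h ⊕ f ⊗ g))))
  pair₊₊ = solve-∀-over ℤ[C₃]-ring
  pair₊₋ : ∀ a b c d e f g h →
    (((a ⊕ b) ⊕ ⊖ (c ⊕ d)) ⊕ ((e ⊕ f) ⊕ ⊖ (g ⊕ h))) ⊗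
    (((a ⊕ b) ⊕ ⊖ (c ⊕ d)) ⊕ ⊖ ((e ⊕ f) ⊕ ⊖ (g ⊕ h))) ≡
    (a ⊗ a ⊕ b ⊗ b ⊕ c ⊗ c ⊕ d ⊗ d ⊕ ⊖ (e ⊗ e ⊕ f ⊗ f ⊕ g ⊗ g ⊕ h ⊗ h)) ⊕
    2# ⊗ ((a ⊗ b ⊕ c ⊗ d ⊕ ⊖ (e ⊗ f ⊕ g ⊗ h)) ⊕
          ⊖ ((a ⊗ c ⊕ b ⊗ d ⊕ ⊖ (e ⊗ g ⊕ f ⊗ h)) ⊕ (a ⊗ d ⊕ b ⊗ c ⊕ ⊖ (e ⊗ h ⊕ f ⊗ g))))
  pair₊₋ = solve-∀-over ℤ[C₃]-ring
  pair₋₊ : ∀ a b c d e f g h →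
    (((a ⊕ ⊖ b) ⊕ (c ⊕ ⊖ d)) ⊕ ((e ⊕ ⊖ f) ⊕ (g ⊕ ⊖ h))) ⊗
    (((a ⊕ ⊖ b) ⊕ (c ⊕ ⊖ d)) ⊕ ⊖ ((e ⊕ ⊖ f) ⊕ (g ⊕ ⊖ h))) ≡
    (a ⊗ a ⊕ b ⊗ b ⊕ c ⊗ c ⊕ d ⊗ d ⊕ ⊖ (e ⊗ e ⊕ f ⊗ f ⊕ g ⊗ g ⊕ h ⊗ h)) ⊕
    2# ⊗ (⊖ (a ⊗ b ⊕ c ⊗ d ⊕ ⊖ (e ⊗ f ⊕ g ⊗ h)) ⊕
          ((a ⊗ c ⊕ b ⊗ d ⊕ ⊖ (e ⊗ g ⊕ f ⊗ h)) ⊕ ⊖ (a ⊗ d ⊕ b ⊗ c ⊕ ⊖ (e ⊗ h ⊕ f ⊗ g))))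
  pair₋₊ = solve-∀-over ℤ[C₃]-ring
  pair₋₋ : ∀ a b c d e f g h →
    (((a ⊕ ⊖ b) ⊕ ⊖ (c ⊕ ⊖ d)) ⊕ ((e ⊕ ⊖ f) ⊕ ⊖ (g ⊕ ⊖ h))) ⊗
    (((a ⊕ ⊖ b) ⊕ ⊖ (c ⊕ ⊖ d)) ⊕ ⊖ ((e ⊕ ⊖ f) ⊕ ⊖ (g ⊕ ⊖ h))) ≡
    (a ⊗ a ⊕ b ⊗ b ⊕ c ⊗ c ⊕ d ⊗ d ⊕ ⊖ (e ⊗ e ⊕ f ⊗ f ⊕ g ⊗ g ⊕ h ⊗ h)) ⊕
    2# ⊗ (⊖ (a ⊗ b ⊕ c ⊗ d ⊕ ⊖ (e ⊗ f ⊕ g ⊗ h)) ⊕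
          ⊖ ((a ⊗ c ⊕ b ⊗ d ⊕ ⊖ (e ⊗ g ⊕ f ⊗ h)) ⊕ ⊖ (a ⊗ d ⊕ b ⊗ c ⊕ ⊖ (e ⊗ h ⊕ f ⊗ g))))
  pair₋₋ = solve-∀-over ℤ[C₃]-ring
  squares-sum : ∀ a b c d e f g h →
    (a ⊗ a ⊕ b ⊗ b ⊕ c ⊗ c ⊕ d ⊗ d ⊕ ⊖ (e ⊗ e ⊕ f ⊗ f ⊕ g ⊗ g ⊕ h ⊗ h)) ≡
    (((a ⊕ b) ⊕ (c ⊕ d)) ⊕ ((e ⊕ f) ⊕ (g ⊕ h))) ⊗
    ((((a ⊕ b) ⊕ (c ⊕ d)) ⊕ ((e ⊕ f) ⊕ (g ⊕ h))) ⊕ ⊖ (2# ⊗ (e ⊕ f ⊕ g ⊕ h))) ⊕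
    2# ⊗ (e ⊗ f ⊕ e ⊗ g ⊕ e ⊗ h ⊕ f ⊗ g ⊕ f ⊗ h ⊕ g ⊗ h ⊕
          ⊖ (a ⊗ b ⊕ a ⊗ c ⊕ a ⊗ d ⊕ b ⊗ c ⊕ b ⊗ d ⊕ c ⊗ d))
  squares-sum = solve-∀-over ℤ[C₃]-ring
  halve : ∀ t s w → (1# ⊕ 2# ⊗ t) ⊗ (1# ⊕ 2# ⊗ t ⊕ ⊖ (2# ⊗ s)) ⊕ 2# ⊗ w ≡
    1# ⊕ 2# ⊗ (t ⊕ (t ⊕ ⊖ s) ⊕ 2# ⊗ (t ⊗ (t ⊕ ⊖ s)) ⊕ w)
  halve = solve-∀-over ℤ[C₃]-ring
  regroup : ∀ u x y → 1# ⊕ 2# ⊗ u ⊕ 2# ⊗ (x ⊕ y) ≡ 1# ⊕ 2# ⊗ (u ⊕ x ⊕ y)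
  regroup = solve-∀-over ℤ[C₃]-ring
  T≡1+2u : T ≡ 1# ⊕ 2# ⊗ u
  -- If A is the sum of the first four coefficients, the trivial value is A + `B`, and `T` is (A +
  -- `B`)(A - `B`) up to the mixed products collected in `w`.
  T≡1+2u = begin
    T
      ≡⟨ squares-sum (a 0F) (a 1F) (a 2F) (a 3F) (a 4F) (a 5F) (a 6F) (a 7F) ⟩
    value a ⁺ ⁺ ⁺ ⊗ (value a ⁺ ⁺ ⁺ ⊕ ⊖ (2# ⊗ B)) ⊕ 2# ⊗ w
      ≡⟨ cong (λ v → v ⊗ (v ⊕ ⊖ (2# ⊗ B)) ⊕ 2# ⊗ w) value≡1+2t ⟩
    (1# ⊕ 2# ⊗ t) ⊗ (1# ⊕ 2# ⊗ t ⊕ ⊖ (2# ⊗ B)) ⊕ 2# ⊗ w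
      ≡⟨ halve t B w ⟩
    1# ⊕ 2# ⊗ u  ∎
  pair : ∀ {v} x y → v ≡ T ⊕ 2# ⊗ (x ⊕ y) → v ≡ 1# ⊕ 2# ⊗ (u ⊕ x ⊕ y)
  pair x y eq = trans eq (trans (cong (_⊕ 2# ⊗ (x ⊕ y)) T≡1+2u) (regroup u x y))

⊗-distribˡ-⊕[] : ∀ w p s q → w ⊗ (p ⊕[ s ] q) ≡ (w ⊗ p) ⊕[ s ] (w ⊗ q)
⊗-distribˡ-⊕[] w p ⁺ q = ⊗-distribˡ-⊕ w p q
⊗-distribˡ-⊕[] w p ⁻ q = l w p q
  where
  l : ∀ w p q → w ⊗ (p ⊕ ⊖ q) ≡ w ⊗ p ⊕ ⊖ (w ⊗ q)
  l = solve-∀-over ℤ[C₃]-ring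

value-scale : ∀ w a r s t → value (λ i → w ⊗ a i) r s t ≡ w ⊗ value a r s t
value-scale w a r s t = sym (begin
  w ⊗ value a r s t
    ≡⟨ ⊗-distribˡ-⊕[] w _ t _ ⟩
  (w ⊗ ((a 0F ⊕[ r ] a 1F) ⊕[ s ] (a 2F ⊕[ r ] a 3F))) ⊕[ t ] (w ⊗ ((a 4F ⊕[ r ] a 5F) ⊕[ s ] (a 6F ⊕[ r ] a 7F)))
    ≡⟨ cong₂ _⊕[ t ]_ (half (a 0F) (a 1F) (a 2F) (a 3F)) (half (a 4F) (a 5F) (a 6F) (a 7F)) ⟩
  value (λ i → w ⊗ a i) r s t  ∎)
  where
  half : ∀ p q p′ q′ → w ⊗ ((p ⊕[ r ] q) ⊕[ s ] (p′ ⊕[ r ] q′)) ≡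
                       ((w ⊗ p) ⊕[ r ] (w ⊗ q)) ⊕[ s ] ((w ⊗ p′) ⊕[ r ] (w ⊗ q′))
  half p q p′ q′ = trans (⊗-distribˡ-⊕[] w (p ⊕[ r ] q) s (p′ ⊕[ r ] q′))
    (cong₂ _⊕[ s ]_ (⊗-distribˡ-⊕[] w p r q) (⊗-distribˡ-⊕[] w p′ r q′))

norm-pair : (Fin 8 → ℤ[C₃]) → Sign → Sign → ℤ
norm-pair a r s = N (value a r s ⁺) * N (value a r s ⁻)

norm-product : (Fin 8 → ℤ[C₃]) → ℤ
norm-product a = (norm-pair a ⁺ ⁺ * norm-pair a ⁺ ⁻) * (norm-pair a ⁻ ⁺ * norm-pair a ⁻ ⁻)

N-value-product : ∀ a → N (value-product a) ≡ norm-product a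
N-value-product a = begin
  N (value-product a)
    ≡⟨ N-⊗ (value-pair a ⁺ ⁺ ⊗ value-pair a ⁺ ⁻) (value-pair a ⁻ ⁺ ⊗ value-pair a ⁻ ⁻) ⟩
  N (value-pair a ⁺ ⁺ ⊗ value-pair a ⁺ ⁻) * N (value-pair a ⁻ ⁺ ⊗ value-pair a ⁻ ⁻)
    ≡⟨ cong₂ _*_ (half ⁺) (half ⁻) ⟩
  norm-product a  ∎
  where
  half : ∀ r → N (value-pair a r ⁺ ⊗ value-pair a r ⁻) ≡ norm-pair a r ⁺ * norm-pair a r ⁻
  half r = trans (N-⊗ (value-pair a r ⁺) (value-pair a r ⁻))
    (cong₂ _*_ (N-⊗ (value a r ⁺ ⁺) (value a r ⁺ ⁻)) (N-⊗ (value a r ⁻ ⁺) (value a r ⁻ ⁻)))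

-- Allows the trivial value to be normalized to 1 modulo 2 by an element of C₃ without changing the
-- determinant.
norm-product-scale : ∀ w a → N w ≡ 1ℤ → norm-product (λ i → w ⊗ a i) ≡ norm-product a
norm-product-scale w a Nw≡1 = cong₂ _*_ (cong₂ _*_ (pair ⁺ ⁺) (pair ⁺ ⁻)) (cong₂ _*_ (pair ⁻ ⁺) (pair ⁻ ⁻))
  where
  single : ∀ r s t → N (value (λ i → w ⊗ a i) r s t) ≡ N (value a r s t)
  single r s t = begin
    N (value (λ i → w ⊗ a i) r s t)  ≡⟨ cong N (value-scale w a r s t) ⟩
    N (w ⊗ value a r s t)            ≡⟨ N-⊗ w (value a r s t) ⟩
    N w * N (value a r s t)          ≡⟨ cong (_* N (value a r s t)) Nw≡1 ⟩
    1ℤ * N (value a r s t)           ≡⟨ ℤ.*-identityˡ (N (value a r s t)) ⟩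
    N (value a r s t)                ∎
  pair : ∀ r s → norm-pair (λ i → w ⊗ a i) r s ≡ norm-pair a r s
  pair r s = cong₂ _*_ (single r s ⁺) (single r s ⁻)

-- Parity of norms and units modulo 2

Even : ℤ → Set
Even x = ∃[ k ] x ≡ + 2 * k

Even⇒¬Odd : ∀ {x} → Even x → ¬ Odd x
Even⇒¬Odd (k , x≡2k) odd = odd (Signed.∣⇒∣ᵤ (Signed.divides k (trans x≡2k (ℤ.*-comm (+ 2) k))))

Even-*ˡ : ∀ {x} y → Even x → Even (x * y)
Even-*ˡ y (k , x≡2k) = k * y , trans (cong (_* y) x≡2k) (ℤ.*-assoc (+ 2) k y)

even⊎odd : ∀ x → Even x ⊎ (∃[ k ] x ≡ + 1 + + 2 * k)
even⊎odd x with x ℤ.%ℕ 2 | ℤ.n%ℕd<d x 2 | ℤ.a≡a%ℕn+[a/ℕn]*n x 2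
... | 0 | _ | x≡2k = inj₁ (x ℤ./ℕ 2 , trans x≡2k (trans (ℤ.+-identityˡ _) (ℤ.*-comm (x ℤ./ℕ 2) (+ 2))))
... | 1 | _ | x≡1+2k = inj₂ (x ℤ./ℕ 2 , trans x≡1+2k (cong (λ k → + 1 + k) (ℤ.*-comm (x ℤ./ℕ 2) (+ 2))))
... | ℕ.suc (ℕ.suc _) | ℕ.s≤s (ℕ.s≤s ()) | _

norm-factor : ∀ x y z → norm x y z ≡ (x + y + z) * (x * x + y * y + z * z - x * y - y * z - z * x)
norm-factor = l
  where
  l : ∀ x y z → x * x * x + y * y * y + z * z * z - + 3 * (x * y * z) ≡
      (x + y + z) * (x * x + y * y + z * z - x * y - y * z - z * x)
  l = solve-∀

norm-even : ∀ x y z → Even (x + y + z) → Even (norm x y z)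
norm-even x y z even = subst Even (sym (norm-factor x y z)) (Even-*ˡ _ even)

-- The sum of the coefficients is odd here; evenness comes from the quadratic factor of `norm`,
-- which depends only on the differences of the coefficients.
norm-even-111 : ∀ a b c → Even (norm (+ 1 + + 2 * a) (+ 1 + + 2 * b) (+ 1 + + 2 * c))
norm-even-111 a b c = _ , l a b c
  where
  l : ∀ a b c → let x = + 1 + + 2 * a; y = + 1 + + 2 * b; z = + 1 + + 2 * c in
      x * x * x + y * y * y + z * z * z - + 3 * (x * y * z) ≡
      + 2 * ((x + y + z) * (+ 2 * ((a - c) * (a - c) - (a - c) * (b - c) + (b - c) * (b - c))))
  l = solve-∀

1+scalar : ∀ n a b c → ⟨ + 1 + n * a , n * b , n * c ⟩ ≡ 1# ⊕ ⟨ n , + 0 , + 0 ⟩ ⊗ ⟨ a , b , c ⟩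
1+scalar n a b c = coeffs-injective ⟨ + 1 + n * a , n * b , n * c ⟩ (1# ⊕ ⟨ n , + 0 , + 0 ⟩ ⊗ ⟨ a , b , c ⟩)
  (l₀ n a b c) (l₁ n b a c) (l₁ n c b a)
  where
  l₀ : ∀ n a b c → + 1 + n * a ≡ + 1 + (n * a + + 0 * c + + 0 * b)
  l₀ = solve-∀
  l₁ : ∀ n a b c → n * a ≡ + 0 + (n * a + + 0 * b + + 0 * c)
  l₁ = solve-∀

rotate : ∀ x y z → ⟨ + 0 , + 1 , + 0 ⟩ ⊗ ⟨ x , y , z ⟩ ≡ ⟨ z , x , y ⟩
rotate x y z = coeffs-injective (⟨ + 0 , + 1 , + 0 ⟩ ⊗ ⟨ x , y , z ⟩) ⟨ z , x , y ⟩ (l₀ x y z) (l₁ x y z) (l₂ x y z)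
  where
  l₀ : ∀ x y z → + 0 * x + + 1 * z + + 0 * y ≡ z
  l₀ = solve-∀
  l₁ : ∀ x y z → + 0 * y + + 1 * x + + 0 * z ≡ x
  l₁ = solve-∀
  l₂ : ∀ x y z → + 0 * z + + 1 * y + + 0 * x ≡ y
  l₂ = solve-∀

rotate² : ∀ x y z → ⟨ + 0 , + 0 , + 1 ⟩ ⊗ ⟨ x , y , z ⟩ ≡ ⟨ y , z , x ⟩
rotate² x y z = coeffs-injective (⟨ + 0 , + 0 , + 1 ⟩ ⊗ ⟨ x , y , z ⟩) ⟨ y , z , x ⟩ (l₀ x y z) (l₁ x y z) (l₂ x y z)
  where
  l₀ : ∀ x y z → + 0 * x + + 0 * z + + 1 * y ≡ y
  l₀ = solve-∀
  l₁ : ∀ x y z → + 0 * y + + 0 * x + + 1 * z ≡ z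
  l₁ = solve-∀
  l₂ : ∀ x y z → + 0 * z + + 0 * y + + 1 * x ≡ x
  l₂ = solve-∀

-- The units of 𝔽₂[C₃] are the elements of C₃.
odd-norm⇒≡1[2] : ∀ p → Odd (N p) → ∃[ w ] ∃[ t ] (N w ≡ 1ℤ × w ⊗ p ≡ 1# ⊕ 2# ⊗ t)
odd-norm⇒≡1[2] ⟨ x , y , z ⟩ odd with even⊎odd x | even⊎odd y | even⊎odd z
... | inj₁ (a , refl) | inj₁ (b , refl) | inj₁ (c , refl) =
  contradiction odd (Even⇒¬Odd (norm-even (+ 2 * a) (+ 2 * b) (+ 2 * c) (a + b + c , l a b c)))
  where
  l : ∀ a b c → + 2 * a + + 2 * b + + 2 * c ≡ + 2 * (a + b + c)
  l = solve-∀
... | inj₂ (a , refl) | inj₂ (b , refl) | inj₁ (c , refl) =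
  contradiction odd (Even⇒¬Odd (norm-even (+ 1 + + 2 * a) (+ 1 + + 2 * b) (+ 2 * c) (+ 1 + a + b + c , l a b c)))
  where
  l : ∀ a b c → + 1 + + 2 * a + (+ 1 + + 2 * b) + + 2 * c ≡ + 2 * (+ 1 + a + b + c)
  l = solve-∀
... | inj₂ (a , refl) | inj₁ (b , refl) | inj₂ (c , refl) =
  contradiction odd (Even⇒¬Odd (norm-even (+ 1 + + 2 * a) (+ 2 * b) (+ 1 + + 2 * c) (+ 1 + a + b + c , l a b c)))
  where
  l : ∀ a b c → + 1 + + 2 * a + + 2 * b + (+ 1 + + 2 * c) ≡ + 2 * (+ 1 + a + b + c)
  l = solve-∀
... | inj₁ (a , refl) | inj₂ (b , refl) | inj₂ (c , refl) =
  contradiction odd (Even⇒¬Odd (norm-even (+ 2 * a) (+ 1 + + 2 * b) (+ 1 + + 2 * c) (+ 1 + a + b + c , l a b c)))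
  where
  l : ∀ a b c → + 2 * a + (+ 1 + + 2 * b) + (+ 1 + + 2 * c) ≡ + 2 * (+ 1 + a + b + c)
  l = solve-∀
... | inj₂ (a , refl) | inj₂ (b , refl) | inj₂ (c , refl) =
  contradiction odd (Even⇒¬Odd (norm-even-111 a b c))
... | inj₂ (a , refl) | inj₁ (b , refl) | inj₁ (c , refl) =
  1# , ⟨ a , b , c ⟩ , refl , trans (⊗-identityˡ _) (1+scalar (+ 2) a b c)
... | inj₁ (a , refl) | inj₂ (b , refl) | inj₁ (c , refl) =
  ⟨ + 0 , + 0 , + 1 ⟩ , ⟨ b , c , a ⟩ , refl , trans (rotate² (+ 2 * a) (+ 1 + + 2 * b) (+ 2 * c)) (1+scalar (+ 2) b c a)
... | inj₁ (a , refl) | inj₁ (b , refl) | inj₂ (c , refl) =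
  ⟨ + 0 , + 1 , + 0 ⟩ , ⟨ c , a , b ⟩ , refl , trans (rotate (+ 2 * a) (+ 2 * b) (+ 1 + + 2 * c)) (1+scalar (+ 2) c a b)

-- Determinants of E and G

norm-cong : ∀ {x y z x′ y′ z′} → x ≡ x′ → y ≡ y′ → z ≡ z′ → norm x y z ≡ norm x′ y′ z′
norm-cong refl refl refl = refl

-- C₆ is written as C₂ × C₃ with ω at 4 and the involution at 3. So the powers of ω are 0, 4, 2, and
-- adding 3 modulo 6 gives 3, 1, 5.
even-part odd-part : (Fin 6 → ℤ) → ℤ[C₃]
even-part a = ⟨ a 0F , a 4F , a 2F ⟩
odd-part  a = ⟨ a 3F , a 1F , a 5F ⟩

groupDeterminant-C₆-N : ∀ a → groupDeterminant (C 6) a ≡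
  N (even-part a ⊕ odd-part a) * N (even-part a ⊕ ⊖ odd-part a)
groupDeterminant-C₆-N a = trans (groupDeterminant-C₆ a)
  (cong (_* norm (a 0F - a 3F) (a 4F - a 1F) (a 2F - a 5F))
    (norm-cong {a 0F + a 3F} {a 1F + a 4F} {a 2F + a 5F} refl (ℤ.+-comm (a 1F) (a 4F)) refl))

coefficients : (Fin 2 × Fin 2 × Fin 6 → ℤ) → Fin 8 → ℤ[C₃]
coefficients a 0F = even-part λ k → a (0F , 0F , k)
coefficients a 1F = even-part λ k → a (1F , 0F , k)
coefficients a 2F = even-part λ k → a (0F , 1F , k)
coefficients a 3F = even-part λ k → a (1F , 1F , k)
coefficients a 4F = odd-part λ k → a (0F , 0F , k)
coefficients a 5F = odd-part λ k → a (1F , 0F , k)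
coefficients a 6F = odd-part λ k → a (0F , 1F , k)
coefficients a 7F = odd-part λ k → a (1F , 1F , k)

groupDeterminant-C₂×C₂×C₆ : ∀ a → groupDeterminant {0ℓ} {0ℓ} (C 2 ×ᴳ C 2 ×ᴳ C 6) a ≡ norm-product (coefficients a)
groupDeterminant-C₂×C₂×C₆ a = begin
  groupDeterminant {0ℓ} {0ℓ} (C 2 ×ᴳ C 2 ×ᴳ C 6) a
    ≡⟨ groupDeterminant-C₂× (C 2 ×ᴳ C 6) a ⟩
  groupDeterminant {0ℓ} {0ℓ} (C 2 ×ᴳ C 6) a₊ * groupDeterminant {0ℓ} {0ℓ} (C 2 ×ᴳ C 6) a₋
    ≡⟨ cong₂ _*_ (groupDeterminant-C₂× (C 6) a₊) (groupDeterminant-C₂× (C 6) a₋) ⟩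
  (groupDeterminant (C 6) a₊₊ * groupDeterminant (C 6) a₊₋) * (groupDeterminant (C 6) a₋₊ * groupDeterminant (C 6) a₋₋)
    ≡⟨ cong₂ _*_ (cong₂ _*_ (pair a₊₊ ⁺ ⁺ refl refl) (pair a₊₋ ⁺ ⁻ refl refl))
                 (cong₂ _*_ (pair a₋₊ ⁻ ⁺ refl refl) (pair a₋₋ ⁻ ⁻ refl refl)) ⟩
  norm-product (coefficients a)  ∎
  where
  a₊ a₋ : Fin 2 × Fin 6 → ℤ
  a₊ h = a (0F , h) + a (1F , h)
  a₋ h = a (0F , h) - a (1F , h)
  a₊₊ a₊₋ a₋₊ a₋₋ : Fin 6 → ℤ
  a₊₊ k = a₊ (0F , k) + a₊ (1F , k)
  a₊₋ k = a₊ (0F , k) - a₊ (1F , k)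
  a₋₊ k = a₋ (0F , k) + a₋ (1F , k)
  a₋₋ k = a₋ (0F , k) - a₋ (1F , k)
  pair : ∀ b r s → even-part b ⊕ odd-part b ≡ value (coefficients a) r s ⁺ →
         even-part b ⊕ ⊖ odd-part b ≡ value (coefficients a) r s ⁻ →
         groupDeterminant (C 6) b ≡ norm-pair (coefficients a) r s
  pair b r s eq₊ eq₋ = trans (groupDeterminant-C₆-N b) (cong₂ (λ p q → N p * N q) eq₊ eq₋)

N-≡1[8] : ∀ m → ∃[ x ] ∃[ y ] ∃[ z ] N (1# ⊕ 8# ⊗ m) ≡ norm (+ 1 + + 8 * x) (+ 8 * y) (+ 8 * z)
N-≡1[8] ⟨ x , y , z ⟩ = x , y , z , cong N (sym (1+scalar (+ 8) x y z))

Odd-*ˡ : ∀ x y → Odd (x * y) → Odd x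
Odd-*ˡ x y odd 2∣x = odd (Signed.∣⇒∣ᵤ {+ 2} {x * y} (Signed.∣m⇒∣m*n {+ 2} {x} y (Signed.∣ᵤ⇒∣ {+ 2} {x} 2∣x)))

norm-product-odd : ∀ a → Odd (norm-product a) →
  ∃[ x ] ∃[ y ] ∃[ z ] norm-product a ≡ norm (+ 1 + + 8 * x) (+ 8 * y) (+ 8 * z)
norm-product-odd a odd =
  let w , t , Nw≡1 , w⊗value≡1+2t = odd-norm⇒≡1[2] (value a ⁺ ⁺ ⁺) odd-value
      m , product≡1+8m = value-product-≡1[8] (λ i → w ⊗ a i) t (trans (value-scale w a ⁺ ⁺ ⁺) w⊗value≡1+2t)
      x , y , z , N≡ = N-≡1[8] m
  in x , y , z , trans (sym (norm-product-scale w a Nw≡1))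
       (trans (sym (N-value-product (λ i → w ⊗ a i))) (trans (cong N product≡1+8m) N≡))
  where
  odd-value : Odd (N (value a ⁺ ⁺ ⁺))
  odd-value = Odd-*ˡ (N (value a ⁺ ⁺ ⁺)) (N (value a ⁺ ⁺ ⁻))
    (Odd-*ˡ (norm-pair a ⁺ ⁺) (norm-pair a ⁺ ⁻)
      (Odd-*ˡ (norm-pair a ⁺ ⁺ * norm-pair a ⁺ ⁻) (norm-pair a ⁻ ⁺ * norm-pair a ⁻ ⁻) odd))

-- The equation on K keeps its determinant from being unfolded by conversion checking.
odd-determinant-C₂×C₂×C₆ : ∀ {K : FiniteGroup 0ℓ 0ℓ} → K ≡ (C 2 ×ᴳ C 2 ×ᴳ C 6) → ∀ {m} → m ∈ Sₒ K →
  ∃[ x ] ∃[ y ] ∃[ z ] m ≡ norm (+ 1 + + 8 * x) (+ 8 * y) (+ 8 * z)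
odd-determinant-C₂×C₂×C₆ refl {m} ((a , det≡m) , odd) =
  let x , y , z , eq = norm-product-odd (coefficients (Func.to a)) (subst Odd m≡ odd) in x , y , z , trans m≡ eq
  where
  m≡ : m ≡ norm-product (coefficients (Func.to a))
  m≡ = trans (sym det≡m) (groupDeterminant-C₂×C₂×C₆ (Func.to a))

-- Adding a function pulled back from C₃

residue₃ : Fin 12 → Fin 3
residue₃ k = toℕ k mod 3

folded : (Fin 12 → ℤ) → Fin 6 → ℤ
folded = fold {6} {12} refl

-- Named, so that determinants of it are compared without being unfolded.
_+ᵖ_ : (Fin 12 → ℤ) → (Fin 3 → ℤ) → Fin 12 → ℤ
(d +ᵖ e) k = d k + e (residue₃ k)

-- The contribution of the characters of C₁₂ that factor through C₃. Each residue modulo 3 has four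
-- lifts modulo 12, whence the `4`.
leading : (Fin 12 → ℤ) → (Fin 3 → ℤ) → ℤ
leading d e =
  norm (folded d 0F + folded d 3F + + 4 * e 0F)
       (folded d 1F + folded d 4F + + 4 * e 1F)
       (folded d 2F + folded d 5F + + 4 * e 2F)

trailing : (Fin 12 → ℤ) → ℤ
trailing d =
  norm (folded d 0F - folded d 3F) (folded d 4F - folded d 1F) (folded d 2F - folded d 5F) *
  det (twisted {6} {12} refl d)

-- A function pulled back from C₃ is a multiple of the sum over the subgroup C₄, which vanishes at
-- every character nontrivial on C₄. Hence `e` enters the leading factor alone.
groupDeterminant-C₁₂-+ : ∀ d e → groupDeterminant (C 12) (d +ᵖ e) ≡
  leading d e * trailing d
groupDeterminant-C₁₂-+ d e = begin
  groupDeterminant (C 12) (d +ᵖ e)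
    ≡⟨ groupDeterminant-C₁₂ (d +ᵖ e) ⟩
  groupDeterminant (C 6) (fold {6} {12} refl (d +ᵖ e)) * det (twisted {6} {12} refl (d +ᵖ e))
    ≡⟨ cong₂ _*_
         (trans (groupDeterminant-cong (C 6) {fold {6} {12} refl (d +ᵖ e)} {folded (d +ᵖ e)} λ k → refl)
                (groupDeterminant-C₆ (folded (d +ᵖ e))))
         (det-cong {6} {twisted {6} {12} refl (d +ᵖ e)} {twisted {6} {12} refl d} twisted-entry) ⟩
  norm (folded (d +ᵖ e) 0F + folded (d +ᵖ e) 3F)
       (folded (d +ᵖ e) 1F + folded (d +ᵖ e) 4F)
       (folded (d +ᵖ e) 2F + folded (d +ᵖ e) 5F) *
  norm (folded (d +ᵖ e) 0F - folded (d +ᵖ e) 3F)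
       (folded (d +ᵖ e) 4F - folded (d +ᵖ e) 1F)
       (folded (d +ᵖ e) 2F - folded (d +ᵖ e) 5F) *
  det (twisted {6} {12} refl d)
    ≡⟨ cong₂ (λ x y → x * y * det (twisted {6} {12} refl d)) sums differences ⟩
  leading d e *
  norm (folded d 0F - folded d 3F) (folded d 4F - folded d 1F) (folded d 2F - folded d 5F) *
  det (twisted {6} {12} refl d)
    ≡⟨ ℤ.*-assoc (leading d e) (norm (folded d 0F - folded d 3F) (folded d 4F - folded d 1F) (folded d 2F - folded d 5F))
                 (det (twisted {6} {12} refl d)) ⟩
  leading d e * trailing d  ∎
  where
  10F 11F : Fin 12
  10F = suc 9F
  11F = suc (suc 9F)
  sum : ∀ p q r s e → (p + e + (q + e)) + (r + e + (s + e)) ≡ (p + q) + (r + s) + + 4 * e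
  sum = solve-∀
  difference : ∀ p q r s e → (p + e + (q + e)) - (r + e + (s + e)) ≡ (p + q) - (r + s)
  difference = solve-∀
  sums :
    norm (folded (d +ᵖ e) 0F + folded (d +ᵖ e) 3F)
         (folded (d +ᵖ e) 1F + folded (d +ᵖ e) 4F)
         (folded (d +ᵖ e) 2F + folded (d +ᵖ e) 5F) ≡
    leading d e
  sums = norm-cong
    {folded (d +ᵖ e) 0F + folded (d +ᵖ e) 3F}
    {folded (d +ᵖ e) 1F + folded (d +ᵖ e) 4F}
    {folded (d +ᵖ e) 2F + folded (d +ᵖ e) 5F}
    {folded d 0F + folded d 3F + + 4 * e 0F} {folded d 1F + folded d 4F + + 4 * e 1F} {folded d 2F + folded d 5F + + 4 * e 2F}
    (sum (d 0F) (d 6F) (d 3F) (d 9F) (e 0F))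
    (sum (d 1F) (d 7F) (d 4F) (d 10F) (e 1F))
    (sum (d 2F) (d 8F) (d 5F) (d 11F) (e 2F))
  differences :
    norm (folded (d +ᵖ e) 0F - folded (d +ᵖ e) 3F)
         (folded (d +ᵖ e) 4F - folded (d +ᵖ e) 1F)
         (folded (d +ᵖ e) 2F - folded (d +ᵖ e) 5F) ≡
    norm (folded d 0F - folded d 3F) (folded d 4F - folded d 1F) (folded d 2F - folded d 5F)
  differences = norm-cong
    {folded (d +ᵖ e) 0F - folded (d +ᵖ e) 3F}
    {folded (d +ᵖ e) 4F - folded (d +ᵖ e) 1F}
    {folded (d +ᵖ e) 2F - folded (d +ᵖ e) 5F}
    {folded d 0F - folded d 3F} {folded d 4F - folded d 1F} {folded d 2F - folded d 5F}
    (difference (d 0F) (d 6F) (d 3F) (d 9F) (e 0F))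
    (difference (d 4F) (d 10F) (d 1F) (d 7F) (e 1F))
    (difference (d 2F) (d 8F) (d 5F) (d 11F) (e 2F))
  cancel : ∀ p q e → (p + e) - (q + e) ≡ p - q
  cancel = solve-∀
  same-residue : ∀ i j → residue₃ (diff 12 (i ↑ˡ 6) (j ↑ˡ 6)) ≡ residue₃ (diff 12 (i ↑ˡ 6) (6 ↑ʳ j))
  same-residue = from-yes (all? {6} λ i → all? {6} λ j →
    residue₃ (diff 12 (i ↑ˡ 6) (j ↑ˡ 6)) ≟ residue₃ (diff 12 (i ↑ˡ 6) (6 ↑ʳ j)))
  twisted-entry : ∀ i j → twisted {6} {12} refl (d +ᵖ e) i j ≡ twisted {6} {12} refl d i j
  twisted-entry i j = trans
    (cong (λ k → (d p + e k) - (d q + e (residue₃ q))) (same-residue i j))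
    (cancel (d p) (d q) (e (residue₃ q)))
    where
    p q : Fin 12
    p = diff 12 (i ↑ˡ 6) (j ↑ˡ 6)
    q = diff 12 (i ↑ˡ 6) (6 ↑ʳ j)

_⊞_ _⊟_ : (Fin 12 → ℤ) → (Fin 12 → ℤ) → Fin 12 → ℤ
(d₀ ⊞ d₁) k = d₀ k + d₁ k
(d₀ ⊟ d₁) k = d₀ k - d₁ k

-- The group ring element d₀ + d₁ σ, σ generating C 2, plus e pulled back from C 3.
element₂₄ : (Fin 12 → ℤ) → (Fin 12 → ℤ) → (Fin 3 → ℤ) → Fin 2 × Fin 12 → ℤ
element₂₄ d₀ d₁ e (0F , k) = (d₀ +ᵖ e) k
element₂₄ d₀ d₁ e (1F , k) = (d₁ +ᵖ e) k

-- The trivial character of `C 2` doubles `e` and the other one cancels it. With the `4` in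
-- `leading` the total multiplier is 8, the order of C₂ × C₄.
groupDeterminant-C₂×C₁₂ : ∀ d₀ d₁ e → groupDeterminant {0ℓ} {0ℓ} (C 2 ×ᴳ C 12) (element₂₄ d₀ d₁ e) ≡
  (leading (d₀ ⊞ d₁) (λ i → + 2 * e i) * trailing (d₀ ⊞ d₁)) *
  (leading (d₀ ⊟ d₁) (λ _ → 0ℤ) * trailing (d₀ ⊟ d₁))
groupDeterminant-C₂×C₁₂ d₀ d₁ e = trans (groupDeterminant-C₂× (C 12) (element₂₄ d₀ d₁ e)) (cong₂ _*_
  (trans
    (groupDeterminant-cong (C 12)
      {λ k → element₂₄ d₀ d₁ e (0F , k) + element₂₄ d₀ d₁ e (1F , k)}
      {(d₀ ⊞ d₁) +ᵖ (λ i → + 2 * e i)}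
      λ k → sum (d₀ k) (d₁ k) (e (residue₃ k)))
    (groupDeterminant-C₁₂-+ (d₀ ⊞ d₁) (λ i → + 2 * e i)))
  (trans
    (groupDeterminant-cong (C 12)
      {λ k → element₂₄ d₀ d₁ e (0F , k) - element₂₄ d₀ d₁ e (1F , k)}
      {(d₀ ⊟ d₁) +ᵖ (λ _ → 0ℤ)}
      λ k → difference (d₀ k) (d₁ k) (e (residue₃ k)))
    (groupDeterminant-C₁₂-+ (d₀ ⊟ d₁) (λ _ → 0ℤ))))
  where
  sum : ∀ p q e → (p + e) + (q + e) ≡ p + q + + 2 * e
  sum = solve-∀
  difference : ∀ p q e → (p + e) - (q + e) ≡ p - q + 0ℤ
  difference = solve-∀

∈S : (K : FiniteGroup 0ℓ 0ℓ) (a : FiniteGroup.Carrier K → ℤ) →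
     (∀ {g h} → FiniteGroup._≈_ K g h → a g ≡ a h) → ∀ {m} → groupDeterminant K a ≡ m → m ∈ S K
∈S K a a-cong eq = record { to = a ; cong = a-cong } , eq

element₂₄-cong : ∀ d₀ d₁ e {g h} → FiniteGroup._≈_ (C 2 ×ᴳ C 12) g h →
                 element₂₄ d₀ d₁ e g ≡ element₂₄ d₀ d₁ e h
element₂₄-cong d₀ d₁ e (refl , refl) = refl

∈S-C₂×C₁₂ : ∀ d₀ d₁ e {m} →
  (leading (d₀ ⊞ d₁) (λ i → + 2 * e i) * trailing (d₀ ⊞ d₁)) *
  (leading (d₀ ⊟ d₁) (λ _ → 0ℤ) * trailing (d₀ ⊟ d₁)) ≡ m → m ∈ S {0ℓ} {0ℓ} (C 2 ×ᴳ C 12)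
∈S-C₂×C₁₂ d₀ d₁ e {m} eq = ∈S (C 2 ×ᴳ C 12) (element₂₄ d₀ d₁ e)
  (λ {g} {h} → element₂₄-cong d₀ d₁ e {g} {h}) (trans (groupDeterminant-C₂×C₁₂ d₀ d₁ e) eq)

-- Norms of elements congruent to 1 modulo 8

-- The norm of the Eisenstein integer (1 + 8p) + 8q ω.
form : ℤ → ℤ → ℤ
form p q = (+ 1 + + 8 * p) * (+ 1 + + 8 * p) - (+ 1 + + 8 * p) * (+ 8 * q) + (+ 8 * q) * (+ 8 * q)

prime-∣-* : ∀ {p} → Prime p → ∀ x y → + p Signed.∣ x * y → + p Signed.∣ x ⊎ + p Signed.∣ y
prime-∣-* {p} p-prime x y p∣xy = ⊎.map (Signed.∣ᵤ⇒∣ {+ p} {x}) (Signed.∣ᵤ⇒∣ {+ p} {y})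
  (euclidsLemma ∣ x ∣ ∣ y ∣ p-prime (subst (p ℕ.∣_) (ℤ.abs-* x y) (Signed.∣⇒∣ᵤ {+ p} {x * y} p∣xy)))

-- The factors are the value at 1 and the norm of the value at a primitive cube root of unity,
-- rewritten with ω² = -1 - ω.
norm≡sum*form : ∀ x y z → norm (+ 1 + + 8 * x) (+ 8 * y) (+ 8 * z) ≡
  (+ 1 + + 8 * (x + y + z)) * form (x - z) (y - z)
norm≡sum*form = l
  where
  l : ∀ x y z →
    let X = + 1 + + 8 * x
        Y = + 8 * y
        Z = + 8 * z
        p = + 1 + + 8 * (x - z)
        q = + 8 * (y - z)
    in X * X * X + Y * Y * Y + Z * Z * Z - + 3 * (X * Y * Z) ≡ (+ 1 + + 8 * (x + y + z)) * (p * p - p * q + q * q)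
  l = solve-∀

-- ω is 1 modulo the prime above 3, so modulo 3 the form is the square of the value at 1. Therefore
-- 3 divides both factors of the norm or neither.
form-sum : ∀ x y z → ∃[ k ] form (x - z) (y - z) ≡ (+ 1 + + 8 * (x + y + z)) * (+ 1 + + 8 * (x + y + z)) - k * + 3
form-sum x y z =
  (+ 1 + + 8 * x) * (+ 8 * y) + + 8 * y * (+ 8 * z) + + 8 * z * (+ 1 + + 8 * x) , l x y z
  where
  l : ∀ x y z →
    let X = + 1 + + 8 * x
        Y = + 8 * y
        Z = + 8 * z
        p = + 1 + + 8 * (x - z)
        q = + 8 * (y - z)
        s = + 1 + + 8 * (x + y + z)
    in p * p - p * q + q * q ≡ s * s - (X * Y + + 8 * y * (+ 8 * z) + + 8 * z * X) * + 3
  l = solve-∀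

form≡1[8] : ∀ p q → ∃[ k ] form p q - + 1 ≡ k * + 8
form≡1[8] p q = + 2 * p + + 8 * (p * p) - q - + 8 * (p * q) + + 8 * (q * q) , l p q
  where
  l : ∀ p q →
    let P = + 1 + + 8 * p
        Q = + 8 * q
    in P * P - P * Q + Q * Q - + 1 ≡ (+ 2 * p + + 8 * (p * p) - q - + 8 * (p * q) + + 8 * (q * q)) * + 8
  l = solve-∀

-- 73 = N(1 − 8ω), so modulo 73 the form splits with roots −8 and 9.
form-mod-73 : ∀ p q → form p q ≡ (+ 1 + + 8 * p + + 64 * q) * (+ 1 + + 8 * p - + 72 * q) + (+ 64 * (q * q)) * + 73
form-mod-73 = l
  where
  l : ∀ p q →
    let P = + 1 + + 8 * p
        Q = + 8 * q
    in P * P - P * Q + Q * Q ≡ (+ 1 + + 8 * p + + 64 * q) * (+ 1 + + 8 * p - + 72 * q) + (+ 64 * (q * q)) * + 73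
  l = solve-∀

-- Division by a prime above 73 preserves the congruence modulo 8, since these
-- primes can be chosen congruent to 1.
form-÷73 : ∀ p q → + 73 Signed.∣ form p q → ∃[ p′ ] ∃[ q′ ] form p q ≡ + 73 * form p′ q′
form-÷73 p q 73∣form = [_,_]′ first second
  (prime-∣-* (from-yes (prime? 73)) (+ 1 + + 8 * p + + 64 * q) (+ 1 + + 8 * p - + 72 * q) (73∣product 73∣form))
  where
  73∣product : + 73 Signed.∣ form p q → + 73 Signed.∣ (+ 1 + + 8 * p + + 64 * q) * (+ 1 + + 8 * p - + 72 * q)
  73∣product (divides k form≡73k) = divides (k - + 64 * (q * q))
    (l ((+ 1 + + 8 * p + + 64 * q) * (+ 1 + + 8 * p - + 72 * q)) (+ 64 * (q * q)) k (trans (sym (form-mod-73 p q)) form≡73k))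
    where
    l : ∀ a b k → a + b * + 73 ≡ k * + 73 → a ≡ (k - b) * + 73
    l a b k eq = trans (l₁ a b) (trans (cong (_- b * + 73) eq) (l₂ k b))
      where
      l₁ : ∀ a b → a ≡ a + b * + 73 - b * + 73
      l₁ = solve-∀
      l₂ : ∀ k b → k * + 73 - b * + 73 ≡ (k - b) * + 73
      l₂ = solve-∀
  first : + 73 Signed.∣ + 1 + + 8 * p + + 64 * q → ∃[ p′ ] ∃[ q′ ] form p q ≡ + 73 * form p′ q′
  -- The quotient of (1 + 8p) + 8q ω by 9 + 8ω, the conjugate of 1 - 8ω.
  first (divides k eq) = p′ , q - (+ 1 + + 8 * p′) , trans (cong (λ p → form p q) p≡) (l p′ q)
    where
    p′ : ℤ
    -- Since 8 · 9 = 73 - 1, the divisibility says that p is 9 - 8q modulo 73; `p′` is the resulting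
    -- quotient by 73.
    p′ = p + + 8 * q - + 9 * k
    l₁ : ∀ p q k → p ≡ + 9 + + 73 * (p + + 8 * q - + 9 * k) - + 8 * q + + 9 * (k * + 73 - (+ 1 + + 8 * p + + 64 * q))
    l₁ = solve-∀
    l₂ : ∀ p q k → + 9 + + 73 * (p + + 8 * q - + 9 * k) - + 8 * q + + 9 * (k * + 73 - k * + 73) ≡
                   + 9 + + 73 * (p + + 8 * q - + 9 * k) - + 8 * q
    l₂ = solve-∀
    p≡ : p ≡ + 9 + + 73 * p′ - + 8 * q
    p≡ = trans (l₁ p q k)
      (trans (cong (λ x → + 9 + + 73 * (p + + 8 * q - + 9 * k) - + 8 * q + + 9 * (k * + 73 - x)) eq) (l₂ p q k))
    l : ∀ p′ q → form (+ 9 + + 73 * p′ - + 8 * q) q ≡ + 73 * form p′ (q - (+ 1 + + 8 * p′))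
    l = l₃
      where
      l₃ : ∀ r q →
        let P = + 1 + + 8 * (+ 9 + + 73 * r - + 8 * q)
            Q = + 8 * q
            P′ = + 1 + + 8 * r
            Q′ = + 8 * (q - (+ 1 + + 8 * r))
        in P * P - P * Q + Q * Q ≡ + 73 * (P′ * P′ - P′ * Q′ + Q′ * Q′)
      l₃ = solve-∀
  second : + 73 Signed.∣ + 1 + + 8 * p - + 72 * q → ∃[ p′ ] ∃[ q′ ] form p q ≡ + 73 * form p′ q′
  -- For the other root the quotient is by 1 - 8ω itself.
  second (divides k eq) = + 1 + + 9 * r + q , + 1 + + 8 * r + q , trans (cong (λ p → form p q) p≡) (l r q)
    where
    r : ℤ
    r = p - + 9 * q - + 9 * k
    l₁ : ∀ p q k → p ≡ + 9 + + 73 * (p - + 9 * q - + 9 * k) + + 9 * q + + 9 * (k * + 73 - (+ 1 + + 8 * p - + 72 * q))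
    l₁ = solve-∀
    l₂ : ∀ p q k → + 9 + + 73 * (p - + 9 * q - + 9 * k) + + 9 * q + + 9 * (k * + 73 - k * + 73) ≡
                   + 9 + + 73 * (p - + 9 * q - + 9 * k) + + 9 * q
    l₂ = solve-∀
    p≡ : p ≡ + 9 + + 73 * r + + 9 * q
    p≡ = trans (l₁ p q k)
      (trans (cong (λ x → + 9 + + 73 * (p - + 9 * q - + 9 * k) + + 9 * q + + 9 * (k * + 73 - x)) eq) (l₂ p q k))
    l : ∀ r q → form (+ 9 + + 73 * r + + 9 * q) q ≡ + 73 * form (+ 1 + + 9 * r + q) (+ 1 + + 8 * r + q)
    l = l₃
      where
      l₃ : ∀ r q →
        let P = + 1 + + 8 * (+ 9 + + 73 * r + + 9 * q)
            Q = + 8 * q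
            P′ = + 1 + + 8 * (+ 1 + + 9 * r + q)
            Q′ = + 8 * (+ 1 + + 8 * r + q)
        in P * P - P * Q + Q * Q ≡ + 73 * (P′ * P′ - P′ * Q′ + Q′ * Q′)
      l₃ = solve-∀

-- Excluding the values 9 and 585

square-abs : ∀ x → x * x ≡ + (∣ x ∣ ℕ.* ∣ x ∣)
square-abs (+ n)    = sym (ℤ.pos-* n n)
square-abs -[1+ n ] = refl

-- 4 (P² − PQ + Q²) = (2P − Q)² + 3Q²
form-bound : ∀ a b {f n} → + 4 * f ≡ a * a + + 3 * (b * b) → f ≡ + n → 3 ℕ.* (∣ b ∣ ℕ.* ∣ b ∣) ℕ.≤ 4 ℕ.* n
form-bound a b {f} {n} eq f≡n = subst (3 ℕ.* (∣ b ∣ ℕ.* ∣ b ∣) ℕ.≤_) (sym nat-eq)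
  (ℕ.m≤n+m (3 ℕ.* (∣ b ∣ ℕ.* ∣ b ∣)) (∣ a ∣ ℕ.* ∣ a ∣))
  where
  nat-eq : 4 ℕ.* n ≡ ∣ a ∣ ℕ.* ∣ a ∣ ℕ.+ 3 ℕ.* (∣ b ∣ ℕ.* ∣ b ∣)
  nat-eq = ℤ.+-injective (begin
    + (4 ℕ.* n)                                                ≡⟨ ℤ.pos-* 4 n ⟩
    + 4 * + n                                                  ≡⟨ cong (+ 4 *_) f≡n ⟨
    + 4 * f                                                    ≡⟨ eq ⟩
    a * a + + 3 * (b * b)                                      ≡⟨ cong₂ (λ x y → x + + 3 * y) (square-abs a) (square-abs b) ⟩
    + (∣ a ∣ ℕ.* ∣ a ∣) + + 3 * + (∣ b ∣ ℕ.* ∣ b ∣)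
      ≡⟨ cong (λ x → + (∣ a ∣ ℕ.* ∣ a ∣) + x) (ℤ.pos-* 3 (∣ b ∣ ℕ.* ∣ b ∣)) ⟨
    + (∣ a ∣ ℕ.* ∣ a ∣) + + (3 ℕ.* (∣ b ∣ ℕ.* ∣ b ∣))          ≡⟨ ℤ.pos-+ (∣ a ∣ ℕ.* ∣ a ∣) (3 ℕ.* (∣ b ∣ ℕ.* ∣ b ∣)) ⟨
    + (∣ a ∣ ℕ.* ∣ a ∣ ℕ.+ 3 ℕ.* (∣ b ∣ ℕ.* ∣ b ∣))            ∎)

small : ∀ {n b} → n ℕ.≤ 585 → 3 ℕ.* (b ℕ.* b) ℕ.≤ 4 ℕ.* n → b ℕ.≤ 27
-- The first excluded value is 28: 3 · 28² = 2352 exceeds 4 · 585 = 2340.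
small {n} {b} n≤585 3b²≤4n = ℕ.≮⇒≥ λ 27<b → ℕ.<⇒≱ (ℕ.≤-trans
  (from-yes (2341 ℕ.≤? 3 ℕ.* (28 ℕ.* 28))) (ℕ.*-monoʳ-≤ 3 (ℕ.*-mono-≤ 27<b 27<b)))
  (ℕ.≤-trans 3b²≤4n (ℕ.*-monoʳ-≤ 4 n≤585))

eighth : ∀ {n} → 8 ℕ.* n ℕ.≤ 28 → n ℕ.≤ 3
eighth 8n≤28 = ℕ.≮⇒≥ λ 3<n → ℕ.<⇒≱ (from-yes (28 ℕ.<? 32)) (ℕ.≤-trans (ℕ.*-monoʳ-≤ 8 3<n) 8n≤28)

interval : List ℤ
interval = -[1+ 2 ] ∷ -[1+ 1 ] ∷ -[1+ 0 ] ∷ + 0 ∷ + 1 ∷ + 2 ∷ + 3 ∷ []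

∈interval : ∀ x → ∣ x ∣ ℕ.≤ 3 → x ∈ᴸ interval
∈interval -[1+ 2 ] _ = here refl
∈interval -[1+ 1 ] _ = there (here refl)
∈interval -[1+ 0 ] _ = there (there (here refl))
∈interval (+ 0)    _ = there (there (there (here refl)))
∈interval (+ 1)    _ = there (there (there (there (here refl))))
∈interval (+ 2)    _ = there (there (there (there (there (here refl)))))
∈interval (+ 3)    _ = there (there (there (there (there (there (here refl))))))
∈interval -[1+ ℕ.suc (ℕ.suc (ℕ.suc _)) ] (ℕ.s≤s (ℕ.s≤s (ℕ.s≤s ())))
∈interval (+ ℕ.suc (ℕ.suc (ℕ.suc (ℕ.suc _)))) (ℕ.s≤s (ℕ.s≤s (ℕ.s≤s ())))

-- The form is positive definite, and completing the square in either variable bounds the other one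
-- by 27. Passing from 1 + 8p to 8p costs 1, which still leaves `p` between -3 and 3.
form≡n⇒small : ∀ p q n → n ℕ.≤ 585 → form p q ≡ + n → ∣ p ∣ ℕ.≤ 3 × ∣ q ∣ ℕ.≤ 3
form≡n⇒small p q n n≤585 form≡n = eighth ∣8p∣≤28 , eighth (ℕ.≤-trans ∣8q∣≤27 (ℕ.n≤1+n 27))
  where
  P Q : ℤ
  P = + 1 + + 8 * p
  Q = + 8 * q
  complete-Q : ∀ P Q → + 4 * (P * P - P * Q + Q * Q) ≡ (+ 2 * P - Q) * (+ 2 * P - Q) + + 3 * (Q * Q)
  complete-Q = solve-∀
  complete-P : ∀ P Q → + 4 * (P * P - P * Q + Q * Q) ≡ (+ 2 * Q - P) * (+ 2 * Q - P) + + 3 * (P * P)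
  complete-P = solve-∀
  ∣8q∣≤27 : 8 ℕ.* ∣ q ∣ ℕ.≤ 27
  ∣8q∣≤27 = subst (ℕ._≤ 27) (ℤ.abs-* (+ 8) q)
    (small n≤585 (form-bound (+ 2 * P - Q) Q {form p q} {n} (complete-Q P Q) form≡n))
  ∣P∣≤27 : ∣ P ∣ ℕ.≤ 27
  ∣P∣≤27 = small n≤585 (form-bound (+ 2 * Q - P) P {form p q} {n} (complete-P P Q) form≡n)
  8p≡P-1 : ∀ p → + 8 * p ≡ (+ 1 + + 8 * p) - + 1
  8p≡P-1 = solve-∀
  ∣8p∣≤28 : 8 ℕ.* ∣ p ∣ ℕ.≤ 28
  ∣8p∣≤28 = subst (ℕ._≤ 28) (trans (cong ∣_∣ (sym (8p≡P-1 p))) (ℤ.abs-* (+ 8) p))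
    (ℕ.≤-trans (ℤ.∣i-j∣≤∣i∣+∣j∣ P (+ 1)) (ℕ.+-monoˡ-≤ 1 ∣P∣≤27))

-- Behind this check of 49 pairs: 9 is the norm of the associates of 3 only, none of them 1 modulo
-- 8, and 585 is no norm at all, as the inert prime 5 divides it exactly once.
form-misses : All (λ p → All (λ q → form p q ≢ + 9 × form p q ≢ + 585) interval) interval
form-misses = from-yes (All.all? (λ p → All.all? (λ q →
  ¬? (form p q ℤ.≟ + 9) ×-dec ¬? (form p q ℤ.≟ + 585)) interval) interval)

form≢9∧form≢585 : ∀ p q → form p q ≢ + 9 × form p q ≢ + 585
form≢9∧form≢585 p q =
  (λ eq → proj₁ (misses (form≡n⇒small p q 9 (from-yes (9 ℕ.≤? 585)) eq)) eq) ,
  (λ eq → proj₂ (misses (form≡n⇒small p q 585 ℕ.≤-refl eq)) eq)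
  where
  misses : ∣ p ∣ ℕ.≤ 3 × ∣ q ∣ ℕ.≤ 3 → form p q ≢ + 9 × form p q ≢ + 585
  misses (∣p∣≤3 , ∣q∣≤3) = All.lookup (All.lookup form-misses (∈interval p ∣p∣≤3)) (∈interval q ∣q∣≤3)

-- As 3 is its own inverse modulo 8, the residue condition selects the divisors that are 3 modulo 8.
divisors-of-585 : ∀ {n} → n ℕ.< 586 → n ℕ.∣ 585 → n ℕ.* 3 % 8 ≡ 1 → n ≡ 3 ⊎ n ≡ 195
divisors-of-585 = from-yes (ℕ.allUpTo? (λ n → n ℕ.∣? 585 →-dec n ℕ.* 3 % 8 ℕ.≟ 1 →-dec (n ℕ.≟ 3 ⊎-dec n ℕ.≟ 195)) 586)

form-nonneg : ∀ p q → ∃[ n ] form p q ≡ + n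
form-nonneg p q with form p q in eq
... | + n      = n , refl
... | -[1+ n ] = contradiction
  (trans (cong (+ 4 *_) (sym eq)) (trans (complete (+ 1 + + 8 * p) (+ 8 * q)) (cong₂ (λ x y → x + + 3 * y)
    (square-abs (+ 2 * (+ 1 + + 8 * p) - + 8 * q)) (square-abs (+ 8 * q)))))
  (negative≢ n (∣ + 2 * (+ 1 + + 8 * p) - + 8 * q ∣ ℕ.* ∣ + 2 * (+ 1 + + 8 * p) - + 8 * q ∣) (∣ + 8 * q ∣ ℕ.* ∣ + 8 * q ∣))
  where
  complete : ∀ P Q → + 4 * (P * P - P * Q + Q * Q) ≡ (+ 2 * P - Q) * (+ 2 * P - Q) + + 3 * (Q * Q)
  complete = solve-∀
  negative≢ : ∀ n a b → + 4 * -[1+ n ] ≢ + a + + 3 * + b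
  negative≢ n a b eq with () ← trans eq (cong (λ x → + a + x) (sym (ℤ.pos-* 3 b)))

nonneg-quotient : ∀ t {n} → t * + 3 ≡ + n → ∃[ m ] t ≡ + m
nonneg-quotient (+ m)    eq = m , refl
nonneg-quotient -[1+ m ] ()

%8≡1 : ∀ m k → + m - + 1 ≡ k * + 8 → m % 8 ≡ 1
%8≡1 ℕ.zero    k eq = contradiction (Signed.∣⇒∣ᵤ {+ 8} { -[1+ 0 ]} (divides k eq)) (from-no (8 ℕ.∣? 1))
%8≡1 (ℕ.suc m) k eq with ℕ.divides j m≡8j ← Signed.∣⇒∣ᵤ {+ 8} {+ m} (divides k eq) =
  trans (cong (λ m → ℕ.suc m % 8) m≡8j) ([m+kn]%n≡m%n 1 j 8)

9⊎585 : ∀ {s t f n k} → s * t ≡ + 585 → f ≡ t * + 3 → f ≡ + n → f - + 1 ≡ k * + 8 → f ≡ + 9 ⊎ f ≡ + 585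
9⊎585 {s} {t} {f} {n} {k} st≡585 f≡3t f≡n f≡1[8] =
  let m , t≡m = nonneg-quotient t (trans (sym f≡3t) f≡n) in go m t≡m
  where
  go : ∀ m → t ≡ + m → f ≡ + 9 ⊎ f ≡ + 585
  go m t≡m = ⊎.map
    (λ m≡3 → trans f≡3m (cong (λ m → + (m ℕ.* 3)) m≡3))
    (λ m≡195 → trans f≡3m (cong (λ m → + (m ℕ.* 3)) m≡195))
    (divisors-of-585 (ℕ.s≤s (ℕ.∣⇒≤ m∣585)) m∣585 (%8≡1 (m ℕ.* 3) k (trans (cong (_- + 1) (sym f≡3m)) f≡1[8])))
    where
    f≡3m : f ≡ + (m ℕ.* 3)
    f≡3m = trans f≡3t (trans (cong (_* + 3) t≡m) (sym (ℤ.pos-* m 3)))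
    m∣585 : m ℕ.∣ 585
    m∣585 = ℕ.divides ∣ s ∣ (trans (cong ∣_∣ (trans (sym st≡585) (cong (s *_) t≡m))) (ℤ.abs-* s (+ m)))

form≢3*divisor-of-585 : ∀ s t p q → s * t ≡ + 585 → form p q ≢ t * + 3
form≢3*divisor-of-585 s t p q st≡585 form≡3t =
  conclude (proj₁ (form-nonneg p q)) (proj₁ (form≡1[8] p q)) (proj₂ (form-nonneg p q)) (proj₂ (form≡1[8] p q))
  where
  excluded : ¬ (form p q ≡ + 9 ⊎ form p q ≡ + 585)
  excluded (inj₁ form≡9)   = proj₁ (form≢9∧form≢585 p q) form≡9
  excluded (inj₂ form≡585) = proj₂ (form≢9∧form≢585 p q) form≡585
  conclude : ∀ n k → form p q ≡ + n → ¬ (form p q - + 1 ≡ k * + 8)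
  conclude n k form≡n form≡1[8] = excluded (9⊎585 {s} {t} {form p q} {n} {k} st≡585 form≡3t form≡n form≡1[8])

-- Induction on the exponent of 73. Here `s` is one third of the value at 1, which is why the
-- constant is 1755 = 5265 / 3. When the exponent is 0, cancelling the 3 in the form leaves 585.
descent : ∀ k s p q → s * form p q ≡ + 1755 * + (73 ℕ.^ k) → ¬ (+ 3 Signed.∣ form p q)
descent ℕ.zero s p q eq (divides t form≡3t) = form≢3*divisor-of-585 s t p q
  (ℤ.*-cancelʳ-≡ (s * t) (+ 585) (+ 3) (trans (ℤ.*-assoc s t (+ 3)) (trans (cong (s *_) (sym form≡3t)) eq))) form≡3t
descent (ℕ.suc k) s p q eq 3∣form@(divides t form≡3t) = [_,_]′ in-s in-form
  (prime-∣-* (from-yes (prime? 73)) s (form p q) (divides (+ 1755 * + (73 ℕ.^ k)) eq′))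
  where
  reorder : ∀ x → + 1755 * (+ 73 * x) ≡ + 1755 * x * + 73
  reorder = solve-∀
  eq′ : s * form p q ≡ + 1755 * + (73 ℕ.^ k) * + 73
  eq′ = trans eq (trans (cong (+ 1755 *_) (ℤ.pos-* 73 (73 ℕ.^ k))) (reorder (+ (73 ℕ.^ k))))
  in-s : ¬ (+ 73 Signed.∣ s)
  in-s (divides s′ s≡73s′) = descent k s′ p q
    (ℤ.*-cancelʳ-≡ (s′ * form p q) (+ 1755 * + (73 ℕ.^ k)) (+ 73)
      (trans (swap s′ (form p q)) (trans (cong (_* form p q) (sym s≡73s′)) eq′))) 3∣form
    where
    swap : ∀ s f → s * f * + 73 ≡ s * + 73 * f
    swap = solve-∀
  in-form : ¬ (+ 73 Signed.∣ form p q)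
  in-form 73∣form = let p′ , q′ , form≡73form′ = form-÷73 p q 73∣form in reduce p′ q′ form≡73form′
    where
    reduce : ∀ p′ q′ → form p q ≢ + 73 * form p′ q′
    reduce p′ q′ form≡73form′ = descent k s p′ q′
      (ℤ.*-cancelʳ-≡ (s * form p′ q′) (+ 1755 * + (73 ℕ.^ k)) (+ 73)
        (trans (swap s (form p′ q′)) (trans (cong (s *_) (sym form≡73form′)) eq′)))
      -- Divisibility by 3 survives the division by 73 because 73 = 1 + 3 · 24.
      (divides (t - + 24 * form p′ q′)
        (trans (split (form p′ q′)) (trans
          (cong (_- + 72 * form p′ q′) (trans (sym form≡73form′) form≡3t))
          (collect t (form p′ q′)))))
      where
      swap : ∀ s f → s * f * + 73 ≡ s * (+ 73 * f)
      swap = solve-∀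
      split : ∀ f → f ≡ + 73 * f - + 72 * f
      split = solve-∀
      collect : ∀ t f → t * + 3 - + 72 * f ≡ (t - + 24 * f) * + 3
      collect = solve-∀

D≡3* : ∀ r → D r ≡ + 1755 * + (73 ℕ.^ (r ℕ.+ 1)) * + 3
D≡3* r = trans (cong (λ c → + (c ℕ.* 73 ℕ.^ (r ℕ.+ 1))) {3 ℕ.^ 4 ℕ.* 5 ℕ.* 13} {5265} refl)
  (trans (ℤ.pos-* 5265 (73 ℕ.^ (r ℕ.+ 1))) (l (+ (73 ℕ.^ (r ℕ.+ 1)))))
  where
  l : ∀ x → + 5265 * x ≡ + 1755 * x * + 3
  l = solve-∀

D≢norm : ∀ r x y z → D r ≢ norm (+ 1 + + 8 * x) (+ 8 * y) (+ 8 * z)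
D≢norm r x y z D≡norm = 3∣s⇒⊥ ([_,_]′ (λ 3∣s → 3∣s) 3∣f⇒3∣s
  (prime-∣-* 3-prime s f (divides (+ 1755 * + (73 ℕ.^ (r ℕ.+ 1))) sf≡)))
  where
  3-prime : Prime 3
  3-prime = from-yes (prime? 3)
  s f k : ℤ
  s = + 1 + + 8 * (x + y + z)
  f = form (x - z) (y - z)
  k = proj₁ (form-sum x y z)
  f≡ : f ≡ s * s - k * + 3
  f≡ = proj₂ (form-sum x y z)
  sf≡ : s * f ≡ + 1755 * + (73 ℕ.^ (r ℕ.+ 1)) * + 3
  sf≡ = trans (sym (norm≡sum*form x y z)) (trans (sym D≡norm) (D≡3* r))
  3∣f⇒3∣s : + 3 Signed.∣ f → + 3 Signed.∣ s
  3∣f⇒3∣s (divides t f≡3t) = [_,_]′ (λ 3∣s → 3∣s) (λ 3∣s → 3∣s)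
    (prime-∣-* 3-prime s s (divides (t + k) (trans (add (s * s) k)
      (trans (cong (_+ k * + 3) (trans (sym f≡) f≡3t)) (collect t k)))))
    where
    add : ∀ a k → a ≡ a - k * + 3 + k * + 3
    add = solve-∀
    collect : ∀ t k → t * + 3 + k * + 3 ≡ (t + k) * + 3
    collect = solve-∀
  3∣s⇒⊥ : ¬ (+ 3 Signed.∣ s)
  3∣s⇒⊥ (divides t s≡3t) = descent (r ℕ.+ 1) t (x - z) (y - z)
    (ℤ.*-cancelʳ-≡ (t * f) (+ 1755 * + (73 ℕ.^ (r ℕ.+ 1))) (+ 3) (trans (swap t f) (trans (cong (_* f) (sym s≡3t)) sf≡)))
    (divides (t * t * + 3 - k) (trans f≡ (trans (cong (λ s → s * s - k * + 3) s≡3t) (collect t k))))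
    where
    swap : ∀ t f → t * f * + 3 ≡ t * + 3 * f
    swap = solve-∀
    collect : ∀ t k → t * + 3 * (t * + 3) - k * + 3 ≡ (t * t * + 3 - k) * + 3
    collect = solve-∀

-- The comparison of E and G

-- Membership is moved along an equation between groups, so that a group and its unfolded form are
-- compared as groups and not through their determinants.
S-resp-≡ : ∀ {K L : FiniteGroup 0ℓ 0ℓ} → K ≡ L → ∀ {m} → m ∈ S K → m ∈ S L
S-resp-≡ refl m∈S = m∈S

C₂×C₁₂≡G : _≡_ {A = FiniteGroup 0ℓ 0ℓ} (C 2 ×ᴳ C 12) G
C₂×C₁₂≡G = refl

E≡C₂×C₂×C₆ : _≡_ {A = FiniteGroup 0ℓ 0ℓ} E (C 2 ×ᴳ C 2 ×ᴳ C 6)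
E≡C₂×C₂×C₆ = refl

∈S-G : ∀ d₀ d₁ e {m} →
  (leading (d₀ ⊞ d₁) (λ i → + 2 * e i) * trailing (d₀ ⊞ d₁)) *
  (leading (d₀ ⊟ d₁) (λ _ → 0ℤ) * trailing (d₀ ⊟ d₁)) ≡ m → m ∈ S G
∈S-G d₀ d₁ e {m} eq = S-resp-≡ {C 2 ×ᴳ C 12} {G} C₂×C₁₂≡G {m} (∈S-C₂×C₁₂ d₀ d₁ e eq)

one : Fin 12 → ℤ
one 0F = 1ℤ
one (suc _) = 0ℤ

none : Fin 12 → ℤ
none _ = 0ℤ

triple : ℤ → ℤ → ℤ → Fin 3 → ℤ
triple x y z 0F = x
triple x y z 1F = y
triple x y z 2F = z

norm∈S-G : ∀ x y z → norm (+ 1 + + 8 * x) (+ 8 * y) (+ 8 * z) ∈ S G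
norm∈S-G x y z = ∈S-G one none (triple x y z) (trans
  (cong₂ _*_ (cong₂ _*_ lead trail₊) (cong₂ _*_ lead₋ trail₋))
  (collect (norm (+ 1 + + 8 * x) (+ 8 * y) (+ 8 * z))))
  where
  quadruple : ∀ x → + 4 * (+ 2 * x) ≡ + 8 * x
  quadruple = solve-∀
  lead : leading (one ⊞ none) (λ i → + 2 * triple x y z i) ≡ norm (+ 1 + + 8 * x) (+ 8 * y) (+ 8 * z)
  lead = norm-cong {x′ = + 1 + + 8 * x} {+ 8 * y} {+ 8 * z}
    (cong (λ t → + 1 + t) (quadruple x)) (trans (ℤ.+-identityˡ _) (quadruple y)) (trans (ℤ.+-identityˡ _) (quadruple z))
  trail₊ : trailing (one ⊞ none) ≡ 1ℤ
  trail₊ = refl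
  lead₋ : leading (one ⊟ none) (λ _ → 0ℤ) ≡ 1ℤ
  lead₋ = refl
  trail₋ : trailing (one ⊟ none) ≡ 1ℤ
  trail₋ = refl
  collect : ∀ n → n * 1ℤ * (1ℤ * 1ℤ) ≡ n
  collect = solve-∀

-- With x = 1F generating C 12 these are −1 + x⁵ + x⁹ and −1 + x⁶.
β₀ β₁ : Fin 12 → ℤ
β₀ 0F = - 1ℤ
β₀ 5F = 1ℤ
β₀ 9F = 1ℤ
β₀ _  = 0ℤ
β₁ 0F = - 1ℤ
β₁ 6F = 1ℤ
β₁ _  = 0ℤ

73^r≡1[24] : ∀ r → ∃[ m ] 73 ℕ.^ r ≡ 1 ℕ.+ 24 ℕ.* m
73^r≡1[24] ℕ.zero = 0 , refl
-- The new witness comes from 73 = 1 + 24 · 3.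
73^r≡1[24] (ℕ.suc r) = let m , eq = 73^r≡1[24] r in 3 ℕ.+ 73 ℕ.* m , step m eq
  where
  step : ∀ m → 73 ℕ.^ r ≡ 1 ℕ.+ 24 ℕ.* m → 73 ℕ.^ ℕ.suc r ≡ 1 ℕ.+ 24 ℕ.* (3 ℕ.+ 73 ℕ.* m)
  step m eq = trans (cong (73 ℕ.*_) eq) (begin
    73 ℕ.* (1 ℕ.+ 24 ℕ.* m)              ≡⟨ ℕ.*-distribˡ-+ 73 1 (24 ℕ.* m) ⟩
    73 ℕ.+ 73 ℕ.* (24 ℕ.* m)             ≡⟨ cong (73 ℕ.+_) (swap m) ⟩
    1 ℕ.+ (72 ℕ.+ 24 ℕ.* (73 ℕ.* m))     ≡⟨ cong (1 ℕ.+_) (ℕ.*-distribˡ-+ 24 3 (73 ℕ.* m)) ⟨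
    1 ℕ.+ 24 ℕ.* (3 ℕ.+ 73 ℕ.* m)        ∎)
    where
    swap : ∀ m → 73 ℕ.* (24 ℕ.* m) ≡ 24 ℕ.* (73 ℕ.* m)
    swap m = trans (sym (ℕ.*-assoc 73 24 m)) (ℕ.*-assoc 24 73 m)

-- 384345 = 5265 · 73 is the determinant of the element without the multiple of Σ; the other factor
-- is the value 73^r to be produced at the trivial character.
D≡ : ∀ r → ∃[ m ] D r ≡ (+ 1 + + 24 * + m) * + 384345
D≡ r = let m , eq = 73^r≡1[24] r in m , (begin
  + (3 ℕ.^ 4 ℕ.* 5 ℕ.* 13 ℕ.* 73 ℕ.^ (r ℕ.+ 1))
    ≡⟨ cong (λ c → + (c ℕ.* 73 ℕ.^ (r ℕ.+ 1))) {3 ℕ.^ 4 ℕ.* 5 ℕ.* 13} {5265} refl ⟩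
  + (5265 ℕ.* 73 ℕ.^ (r ℕ.+ 1))
    ≡⟨ cong (λ t → + (5265 ℕ.* t)) (ℕ.^-distribˡ-+-* 73 r 1) ⟩
  + (5265 ℕ.* (73 ℕ.^ r ℕ.* 73))
    ≡⟨ cong (λ t → + (5265 ℕ.* (t ℕ.* 73))) eq ⟩
  + (5265 ℕ.* ((1 ℕ.+ 24 ℕ.* m) ℕ.* 73))
    ≡⟨ ℤ.pos-* 5265 ((1 ℕ.+ 24 ℕ.* m) ℕ.* 73) ⟩
  + 5265 * + ((1 ℕ.+ 24 ℕ.* m) ℕ.* 73)
    ≡⟨ cong (+ 5265 *_) (ℤ.pos-* (1 ℕ.+ 24 ℕ.* m) 73) ⟩
  + 5265 * (+ (1 ℕ.+ 24 ℕ.* m) * + 73)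
    ≡⟨ cong (λ t → + 5265 * (t * + 73)) (trans (ℤ.pos-+ 1 (24 ℕ.* m)) (cong (λ t → + 1 + t) (ℤ.pos-* 24 m))) ⟩
  + 5265 * ((+ 1 + + 24 * + m) * + 73)
    ≡⟨ collect (+ 1 + + 24 * + m) ⟩
  (+ 1 + + 24 * + m) * + 384345 ∎)
  where
  collect : ∀ t → + 5265 * (t * + 73) ≡ t * + 384345
  collect = solve-∀

D∈S-G : ∀ r → D r ∈ S G
D∈S-G r = ∈S-G β₀ β₁ (λ _ → + m) (trans
  (cong₂ _*_ (cong₂ _*_ lead trail₊) (cong₂ _*_ lead₋ trail₋))
  (trans (collect (+ 1 + + 24 * + m)) (sym (proj₂ (D≡ r)))))
  where
  m : ℕ
  m = proj₁ (D≡ r)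
  -- Over the residues 0, 1, 2 modulo 3 the coefficients of `β₀ ⊞ β₁` sum to 0, 0, 1. The norm of u,
  -- u, v is (2u + v)(u - v)², and u - v = -1, so only the linear factor 1 + 24m remains.
  lead : leading (β₀ ⊞ β₁) (λ _ → + 2 * + m) ≡ + 1 + + 24 * + m
  lead = l (+ m)
    where
    l : ∀ t → let u = 0ℤ + + 4 * (+ 2 * t); v = 1ℤ + + 4 * (+ 2 * t) in
        u * u * u + u * u * u + v * v * v - + 3 * (u * u * v) ≡ + 1 + + 24 * t
    l = solve-∀
  -- The element is -2 + x⁵ + x⁶ + x⁹. It has value -3 at x = -1 and norm 3 at order 6, giving -9.
  -- At x = i it is -3 + 2i, of norm 13, and at order 12 its norm is 73; 949 = 13 · 73.
  trail₊ : trailing (β₀ ⊞ β₁) ≡ - + 9 * + 949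
  trail₊ = refl
  lead₋ : leading (β₀ ⊟ β₁) (λ _ → 0ℤ) ≡ 1ℤ
  lead₋ = refl
  -- For x⁵ - x⁶ + x⁹ the orders 2 and 6 again give -9. At x = i the value is 1 + 2i, of norm 5, and
  -- at order 12 it is a unit.
  trail₋ : trailing (β₀ ⊟ β₁) ≡ - + 9 * + 5
  trail₋ = refl
  collect : ∀ t → t * (- + 9 * + 949) * (1ℤ * (- + 9 * + 5)) ≡ t * + 384345
  collect = solve-∀

2k+1-odd : ∀ k {x} → x ≡ + 2 * k + + 1 → Odd x
2k+1-odd k {x} x≡2k+1 2∣x with Signed.divides q x≡2q ← Signed.∣ᵤ⇒∣ {+ 2} {x} 2∣x =
  from-no (2 ℕ.∣? 1) (Signed.∣⇒∣ᵤ {+ 2} {+ 1} (Signed.divides (q - k)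
    (trans (cancel k) (trans (cong (_- + 2 * k) (trans (sym x≡2k+1) x≡2q)) (collect q k)))))
  where
  cancel : ∀ k → + 1 ≡ + 2 * k + + 1 - + 2 * k
  cancel = solve-∀
  collect : ∀ q k → q * + 2 - + 2 * k ≡ (q - k) * + 2
  collect = solve-∀

D-odd : ∀ r → Odd (D r)
D-odd r = 2k+1-odd (+ 192172 + + 4612140 * + proj₁ (D≡ r)) {D r} (trans (proj₂ (D≡ r)) (split (+ proj₁ (D≡ r))))
  where
  split : ∀ t → (+ 1 + + 24 * t) * + 384345 ≡ + 2 * (+ 192172 + + 4612140 * t) + + 1
  split = solve-∀

Sₒ-E-norm : ∀ {m} → m ∈ Sₒ E → ∃[ x ] ∃[ y ] ∃[ z ] m ≡ norm (+ 1 + + 8 * x) (+ 8 * y) (+ 8 * z)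
Sₒ-E-norm {m} = odd-determinant-C₂×C₂×C₆ {E} E≡C₂×C₂×C₆ {m}

Sₒ-E⊆Sₒ-G : Sₒ E ⊆ Sₒ G
Sₒ-E⊆Sₒ-G {m} m∈Sₒ-E =
  let x , y , z , m≡norm = Sₒ-E-norm {m} m∈Sₒ-E
  in subst (λ n → n ∈ S G) (sym m≡norm) (norm∈S-G x y z) , proj₂ m∈Sₒ-E

D∉Sₒ-E : ∀ r → D r ∉ Sₒ E
D∉Sₒ-E r D∈Sₒ-E = let x , y , z , D≡norm = Sₒ-E-norm {D r} D∈Sₒ-E in D≢norm r x y z D≡norm

D∈Sₒ-G : ∀ r → D r ∈ Sₒ G
D∈Sₒ-G r = D∈S-G r , D-odd r

theorem6p2 : (Sₒ E ⊂ Sₒ G) × (∀ (r : ℕ) → D r ∈ Sₒ G ∖ Sₒ E)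
theorem6p2 = (Sₒ-E⊆Sₒ-G , λ Sₒ-G⊆Sₒ-E → D∉Sₒ-E 0 (Sₒ-G⊆Sₒ-E (D∈Sₒ-G 0))) , λ r → D∈Sₒ-G r , D∉Sₒ-E r
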